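{- Both of the following hold. (a) There exist a (nonzero) absolutely decaying measure $\mu$ on $\mathbb{R}$ and a decreasing function $\psi:\mathbb{N}\to(0,+\infty)$ such that neither the set of $\psi$-approximable numbers nor its complement has $\mu$-measure $0$. (b) There exist a (nonzero) absolutely decaying measure $\mu$ on $\mathbb{R}$ and a decreasing function $\psi:\mathbb{N}\to(0,+\infty)$ for which the equivalence $$\mu\text{ -almost every point is }\psi\text{ -approximable}\iff\sum_{q=1}^\infty q\,\psi(q)=\infty$$ fails.
   Context: All measures are Borel and locally finite. For $\alpha>0$, a measure $\mu$ on $\mathbb{R}$ is absolutely $\alpha$-decaying if there exists $C>0$ such that $\mu(B(x,\varepsilon r))\le C\varepsilon^\alpha\mu(B(x,r))$ for all $x\in\mathbb{R}$, all $0<r\le1$ and all $0<\varepsilon\le1$; it is absolutely decaying if it is absolutely $\alpha$-decaying for some $\alpha>0$. An irrational $x\in\mathbb{R}$ is $\psi$-approximable if there exist infinitely many rationals $p/q$ (in lowest terms, $q\ge1$) with $|x-p/q|\le\psi(q)$. -}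

module Defs where

open import Algebra.Bundles using (CommutativeRing; Semiring)
open import Algebra.Core using (Op₁; Op₂)
import Algebra.Construct.NaturalChoice.Max as Max
import Algebra.Definitions.RawSemiring as RawSemiringDefs
open import Algebra.Structures using (IsCommutativeRing)
open import Data.Integer.Base using (ℤ; +_; -[1+_])
open import Data.Nat.Base as ℕ using (ℕ; zero; suc)
open import Data.Product.Base using (Σ-syntax; ∃-syntax; _×_)
open import Data.Rational.Base using (ℚ; ↥_; ↧ₙ_)
open import Function.Definitions using (Injective)
open import Level using (0ℓ; _⊔_) renaming (suc to lsuc)
open import Relation.Binary.Bundles using (TotalOrder)
open import Relation.Binary.Core using (Rel)
import Relation.Binary.Construct.Add.Supremum.Equality as AddSupremumEquality
import Relation.Binary.Construct.Add.Supremum.NonStrict as AddSupremumNonStrict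
import Relation.Binary.Construct.NonStrictToStrict as NonStrictToStrict
open import Relation.Binary.PropositionalEquality.Core using (_≡_; _≢_)
open import Relation.Binary.Structures using (IsTotalOrder)
open import Relation.Nullary.Construct.Add.Supremum using (_⁺; [_]; ⊤⁺)
open import Relation.Nullary.Negation.Core using (¬_)
open import Relation.Unary using (Pred; _∈_; _⊆_; _≐_; _⊥_; ∅; U; ∁; ⋃; Satisfiable)

module _ {a ℓ} {A : Set a} (_≤_ : Rel A ℓ) where

  IsUpperBound : ∀ {s} → Pred A s → A → Set (a ⊔ ℓ ⊔ s)
  IsUpperBound S b = ∀ {x} → x ∈ S → x ≤ b

  IsSupremum : ∀ {s} → Pred A s → A → Set (a ⊔ ℓ ⊔ s)
  IsSupremum S b = IsUpperBound S b × (∀ c → IsUpperBound S c → b ≤ c)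

-- The real numbers are characterised, uniquely up to isomorphism, as a
-- complete ordered field.  _⁻¹ and ⨆ are total; their values at 0, and at
-- sets that are empty or unbounded above, are unconstrained.
record CompleteOrderedField : Set₁ where
  infix  4 _≈_ _≤_
  infixl 6 _+_
  infixl 7 _*_
  infix  8 -_
  infix  9 _⁻¹
  field
    Carrier           : Set
    _≈_               : Rel Carrier 0ℓ
    _≤_               : Rel Carrier 0ℓ
    _+_ _*_           : Op₂ Carrier
    -_                : Op₁ Carrier
    0# 1#             : Carrier
    _⁻¹               : Op₁ Carrier
    ⨆                 : Pred Carrier 0ℓ → Carrier
    isCommutativeRing : IsCommutativeRing _≈_ _+_ _*_ -_ 0# 1#
    isTotalOrder      : IsTotalOrder _≈_ _≤_
    0≉1               : ¬ (0# ≈ 1#)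
    ⁻¹-inverseʳ       : ∀ x → ¬ (x ≈ 0#) → x * x ⁻¹ ≈ 1#
    +-monoˡ-≤         : ∀ z {x y} → x ≤ y → x + z ≤ y + z
    *-nonNegative     : ∀ {x y} → 0# ≤ x → 0# ≤ y → 0# ≤ x * y
    ⨆-isSupremum      : ∀ (S : Pred Carrier 0ℓ) → Satisfiable S →
                        (∃[ b ] IsUpperBound _≤_ S b) → IsSupremum _≤_ S (⨆ S)

  commutativeRing : CommutativeRing 0ℓ 0ℓ
  commutativeRing = record { isCommutativeRing = isCommutativeRing }

  totalOrder : TotalOrder 0ℓ 0ℓ 0ℓ
  totalOrder = record { isTotalOrder = isTotalOrder }

module RealAnalysis (R : CompleteOrderedField) where

  open CompleteOrderedField R renaming (Carrier to ℝ)
  open CommutativeRing commutativeRing using (_-_; semiring)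
  open NonStrictToStrict _≈_ _≤_ using (_<_)
  open Max totalOrder using () renaming (_⊔_ to _∨_)
  open RawSemiringDefs (Semiring.rawSemiring semiring) using (_^_) renaming (_×_ to _·_)

  ∣_∣ : ℝ → ℝ
  ∣ x ∣ = x ∨ (- x)

  fromℕ : ℕ → ℝ
  fromℕ n = n · 1#

  fromℤ : ℤ → ℝ
  fromℤ (+ n)    = fromℕ n
  fromℤ -[1+ n ] = - fromℕ (suc n)

  fromℚ : ℚ → ℝ
  fromℚ r = fromℤ (↥ r) * (fromℕ (↧ₙ r)) ⁻¹

  -- Real powers, for base 0 < x ≤ 1 and exponent 0 < α only: there x ^ʳ α is
  -- the infimum of the rational powers x^(p/q) with 0 ≤ p/q ≤ α, i.e. the
  -- largest t ≥ 0 with t^q ≤ x^p for all such p/q.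
  infixr 8 _^ʳ_
  _^ʳ_ : ℝ → ℝ → ℝ
  x ^ʳ α = ⨆ λ t → 0# ≤ t ×
    (∀ (p q : ℕ) .{{_ : ℕ.NonZero q}} → fromℕ p * (fromℕ q) ⁻¹ ≤ α → t ^ q ≤ x ^ p)

  B : ℝ → ℝ → Pred ℝ 0ℓ
  B x r y = ∣ y - x ∣ < r

  IsOpen : Pred ℝ 0ℓ → Set
  IsOpen V = ∀ {x} → x ∈ V → ∃[ r ] 0# < r × B x r ⊆ V

  data IsBorel : Pred ℝ 0ℓ → Set₁ where
    isOpen     : ∀ {V} → IsOpen V → IsBorel V
    complement : ∀ {A} → IsBorel A → IsBorel (∁ A)
    union      : ∀ {A : ℕ → Pred ℝ 0ℓ} → (∀ n → IsBorel (A n)) → IsBorel (⋃ ℕ A)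
    respects   : ∀ {A A′} → A ≐ A′ → IsBorel A → IsBorel A′

  -- ℝ ⁺ is (-∞ , ∞], with ⊤⁺ as ∞; measures take values in its part above 0.
  open AddSupremumNonStrict _≤_ public using (_≤⁺_)
  open AddSupremumEquality _≈_ public using (_≈⁺_)

  infixl 6 _+⁺_
  _+⁺_ : Op₂ (ℝ ⁺)
  [ x ] +⁺ [ y ] = [ x + y ]
  [ x ] +⁺ ⊤⁺    = ⊤⁺
  ⊤⁺    +⁺ y     = ⊤⁺

  -- Only meaningful for a scalar c > 0, since c *⁺ ∞ is ∞.
  infixr 7 _*⁺_
  _*⁺_ : ℝ → ℝ ⁺ → ℝ ⁺
  c *⁺ [ x ] = [ c * x ]
  c *⁺ ⊤⁺    = ⊤⁺

  partialSum : (ℕ → ℝ ⁺) → ℕ → ℝ ⁺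
  partialSum f zero    = [ 0# ]
  partialSum f (suc n) = partialSum f n +⁺ f n

  -- For series of terms ≥ 0.
  HasSum : (ℕ → ℝ ⁺) → ℝ ⁺ → Set
  HasSum f = IsSupremum _≤⁺_ λ s → ∃[ n ] s ≡ partialSum f n

  -- A locally finite Borel measure.  μ is a total function, but its values
  -- matter, and are constrained, on Borel sets only.
  record Measure : Set₁ where
    field
      μ                 : Pred ℝ 0ℓ → ℝ ⁺
      nonNegative       : ∀ {A} → IsBorel A → [ 0# ] ≤⁺ μ A
      cong              : ∀ {A A′} → IsBorel A → IsBorel A′ → A ≐ A′ → μ A ≈⁺ μ A′
      empty             : μ ∅ ≈⁺ [ 0# ]
      countablyAdditive : ∀ (A : ℕ → Pred ℝ 0ℓ) → (∀ n → IsBorel (A n)) →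
                          (∀ {i j} → i ≢ j → A i ⊥ A j) →
                          HasSum (λ n → μ (A n)) (μ (⋃ ℕ A))
      locallyFinite     : ∀ x → ∃[ r ] 0# < r × (∃[ m ] μ (B x r) ≤⁺ [ m ])

  open Measure public using (μ)

  NonzeroMeasure : Measure → Set
  NonzeroMeasure m = ¬ (μ m U ≈⁺ [ 0# ])

  IsAbsolutelyDecayingWithExponent : ℝ → Measure → Set
  IsAbsolutelyDecayingWithExponent α m = ∃[ C ] 0# < C ×
    (∀ x r ε → 0# < r → r ≤ 1# → 0# < ε → ε ≤ 1# →
       μ m (B x (ε * r)) ≤⁺ (C * ε ^ʳ α) *⁺ μ m (B x r))

  IsAbsolutelyDecaying : Measure → Set
  IsAbsolutelyDecaying m = ∃[ α ] 0# < α × IsAbsolutelyDecayingWithExponent α m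

  -- An arbitrary set is null when it is contained in a Borel set of measure 0.
  IsNull : Measure → Pred ℝ 0ℓ → Set₁
  IsNull m A = Σ[ N ∈ Pred ℝ 0ℓ ] IsBorel N × A ⊆ N × μ m N ≈⁺ [ 0# ]

  AlmostEvery : Measure → Pred ℝ 0ℓ → Set₁
  AlmostEvery m A = IsNull m (∁ A)

  Irrational : Pred ℝ 0ℓ
  Irrational x = ∀ (r : ℚ) → ¬ (x ≈ fromℚ r)

  InfinitelyMany : ∀ {A : Set} → Pred A 0ℓ → Set
  InfinitelyMany {A} P = Σ[ f ∈ (ℕ → A) ] Injective _≡_ _≡_ f × (∀ n → P (f n))

  -- An element of ℚ is a fraction in lowest terms, with denominator ↧ₙ r ≥ 1.
  Approximable : (ℕ → ℝ) → Pred ℝ 0ℓ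
  Approximable ψ x = Irrational x ×
    InfinitelyMany λ (r : ℚ) → ∣ x - fromℚ r ∣ ≤ ψ (↧ₙ r)

  Positive : (ℕ → ℝ) → Set
  Positive ψ = ∀ q → 0# < ψ q

  Decreasing : (ℕ → ℝ) → Set
  Decreasing ψ = ∀ {q q′} → q ℕ.≤ q′ → ψ q′ ≤ ψ q

  -- The term of index 0 is 0 · ψ 0, so this is the sum over q ≥ 1.
  KhinchinSeriesDiverges : (ℕ → ℝ) → Set
  KhinchinSeriesDiverges ψ = HasSum (λ q → [ fromℕ q * ψ q ]) ⊤⁺

-- One measure and one function ψ(q) = 1 / (500 (q + 1)²), whose Khinchin series
-- diverges, settle both parts.  The measure is the image of fair coin tossing
-- under a map Φ that reads a sequence of bits as nested Farey intervals
-- [p/q , p′/q′], p′q − pq′ = 1, of comparable denominators.  The first bit fixes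
-- the rule by which children are chosen:
--   * under the first rule every child lies within 1 / (2000 q²) of the left
--     endpoint p/q of its parent, so every point is ψ-approximable;
--   * under the second rule children stay at distance ≥ 1 / (3 (q + q′)²) from
--     both endpoints, while a rational strictly inside [p/q , p′/q′] has
--     denominator ≥ q + q′, so no point is ψ-approximable.
-- Each rule is followed with probability 1/2.  The measure is absolutely
-- decaying because children are separated by gaps comparable to their parent.
module Submission where

open import Defs
open import Algebra.Bundles using (CommutativeRing; Semiring)
import Algebra.Construct.NaturalChoice.Max as Max
import Algebra.Definitions.RawSemiring as RawSemiringDefs
import Algebra.Properties.Ring as RingProperties
import Algebra.Properties.Semiring.Exp as Exp
import Algebra.Properties.Semiring.Mult as Mult
import Algebra.Solver.Ring as RingSolver
open import Algebra.Solver.Ring.AlmostCommutativeRing using (fromCommutativeRing; _-Raw-AlmostCommutative⟶_)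
open import Axiom.ExcludedMiddle using (ExcludedMiddle)
open import Data.Bool.Base using (Bool; true; false)
import Data.Bool.Properties as Bool
open import Data.Empty using (⊥-elim)
open import Data.Integer.Base as ℤ using (ℤ; +_; -[1+_]; _⊖_; _◃_)
import Data.Integer.Properties as ℤ
open import Data.List.Base using (List; []; _∷_; _∷ʳ_; length)
open import Data.Maybe.Base using (Maybe; just; nothing)
open import Data.Nat.Base as ℕ using (ℕ; zero; suc; z≤n; s≤s)
open import Data.Nat.Coprimality using (Coprime)
open import Data.Nat.Divisibility using (_∣_; ∣m+n∣m⇒∣n; ∣m⇒∣m*n; ∣n⇒∣m*n; ∣1⇒≡1)
import Data.Nat.Properties as ℕ
open import Data.Nat.Solver using (module +-*-Solver)
open import Data.Product.Base using (∃-syntax; Σ-syntax; _×_; _,_; proj₁; proj₂)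
open import Data.Rational.Base using (ℚ; mkℚ; ↥_; ↧ₙ_)
import Data.Sign.Base as Sign
open import Data.Sum.Base using (_⊎_; inj₁; inj₂)
open import Function.Bundles using (_⇔_; module Equivalence)
open import Function.Definitions using (Injective)
open import Level using (0ℓ)
open import Relation.Binary.Bundles using (TotalOrder)
open import Relation.Binary.Construct.Add.Supremum.Equality using () renaming ([_] to [_]≈)
open import Relation.Binary.Construct.Add.Supremum.NonStrict using ([_]; _≤⊤⁺; [≤]-injective)
import Relation.Binary.Construct.NonStrictToStrict as NonStrictToStrict
open import Relation.Binary.Definitions using (tri<; tri≈; tri>)
open import Relation.Binary.PropositionalEquality.Core as ≡ using (_≡_; _≢_)
import Relation.Binary.Reasoning.PartialOrder as PosetReasoning
open import Relation.Nullary.Construct.Add.Supremum using ([_]; ⊤⁺)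
open import Relation.Nullary.Decidable.Core using (yes; no)
open import Relation.Nullary.Negation.Core using (¬_; contradiction)
open import Relation.Unary using (Pred; _⊆_; _∩_; ∁)

-- A single bit decides the fate of the point, which defeats a zero-one law; the difficulty is to
-- serve both fates with one ψ. The rules are tuned against each other: the second keeps a point at
-- distance at least 1 / (432 q²) from every fraction of denominator q, so ψ(q) = 1 / (C (q + 1)²)
-- needs C ≥ 433, of which 500 is a round choice; the first is then tightened to match by `N = 4 C`.
-- The coin-tossing measure is built from scratch. Its outer measure is the price of a betting
-- strategy rather than of a cover by cylinders: countable subadditivity is addition of capitals,
-- conditioning on the first bit is a shift of the strategy, and the lower bound 1 for the whole
-- space comes from a sequence on which the gambler never gains. Sequences of bits are functions,
-- compared bit by bit; hence the pointwise equalities in the statements about sections. The Farey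
-- geometry is carried by identities in ℕ: every distance between endpoints is a determinant over a
-- product of denominators.

-- Farey intervals and their subdivision, in natural-number arithmetic.

module Farey where

  open import Data.Nat.Base
  open import Data.Nat.Properties
  open import Relation.Binary.PropositionalEquality.Core using (refl; sym; cong; cong₂; subst)
  open +-*-Solver using (solve; _:=_; con; _:+_; _:*_)
  open ≤-Reasoning

  -- The interval [p / q , p′ / q′].
  record Interval : Set where
    constructor interval
    field
      p q p′ q′ : ℕ
    size : ℕ
    size = q + q′

  -- The child of [p / q , p′ / q′] with left endpoint (a p + b p′) / (a q + b q′)
  -- and right endpoint (c p + d p′) / (c q + d q′).
  record Move : Set where
    constructor move
    field
      a b c d : ℕ

  open Interval
  open Move

  numerator : Interval → ℕ → ℕ → ℕ
  numerator I x y = x * p I + y * p′ I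

  denominator : Interval → ℕ → ℕ → ℕ
  denominator I x y = x * q I + y * q′ I

  step : Move → Interval → Interval
  step m I = interval (numerator I (a m) (b m)) (denominator I (a m) (b m))
                      (numerator I (c m) (d m)) (denominator I (c m) (d m))

  record IsFarey (I : Interval) : Set where
    field
      unimodular : p′ I * q I ≡ p I * q′ I + 1
      0<q        : 0 < q I
      0<q′       : 0 < q′ I
  open IsFarey

  record IsMove (m : Move) : Set where
    field
      unimodular : d m * a m ≡ c m * b m + 1
      0<a        : 0 < a m
      0<b        : 0 < b m
      0<c        : 0 < c m
      0<d        : 0 < d m
  open IsMove

  record Bounded (M : ℕ) (m : Move) : Set where
    field
      a≤ : a m ≤ M
      b≤ : b m ≤ M
      c≤ : c m ≤ M
      d≤ : d m ≤ M
  open Bounded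

  Balanced : ℕ → Interval → Set
  Balanced M I = q I ≤ M * q′ I × q′ I ≤ M * q I

  infix 4 _≺_
  -- The point (x p + y p′) / (x q + y q′) moves right as y / x grows, so the order of two children
  -- can be read from their weights alone: the right end of the child by `m` lies left of the left
  -- end of the child by `n`, in every Farey interval at once.
  _≺_ : Move → Move → Set
  m ≺ n = d m * a n < b n * c m

  -- Determinants are multiplicative and that of a Farey interval is 1, so `k` depends on the
  -- weights only. All distances between endpoints come from here; `k = 1` makes children Farey.
  -- Nothing is subtracted in ℕ: unimodularity and `eq` are substituted into one pair of products
  -- and, once `k` has been split off, substituted back in the other.
  cross : ∀ {I} → IsFarey I → ∀ x y z w {k} → y * z ≡ x * w + k →
          numerator I x y * denominator I z w ≡ numerator I z w * denominator I x y + k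
  cross {interval p q p′ q′} F x y z w {k} eq = begin-equality
    (x * p + y * p′) * (z * q + w * q′)
      ≡⟨ solve 8 (λ p q p′ q′ x y z w → (x :* p :+ y :* p′) :* (z :* q :+ w :* q′) :=
           x :* z :* p :* q :+ y :* w :* p′ :* q′ :+ (x :* w :* (p :* q′) :+ y :* z :* (p′ :* q))) refl p q p′ q′ x y z w ⟩
    x * z * p * q + y * w * p′ * q′ + (x * w * (p * q′) + y * z * (p′ * q))
      ≡⟨ cong (λ v → x * z * p * q + y * w * p′ * q′ + v) (cong₂ (λ s t → x * w * (p * q′) + s * t) eq (IsFarey.unimodular F)) ⟩
    x * z * p * q + y * w * p′ * q′ + (x * w * (p * q′) + (x * w + k) * (p * q′ + 1))
      ≡⟨ solve 4 (λ s t u k → s :+ (t :* u :+ (t :+ k) :* (u :+ con 1)) :=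
           s :+ (t :* (u :+ con 1) :+ (t :+ k) :* u) :+ k) refl (x * z * p * q + y * w * p′ * q′) (x * w) (p * q′) k ⟩
    x * z * p * q + y * w * p′ * q′ + (x * w * (p * q′ + 1) + (x * w + k) * (p * q′)) + k
      ≡⟨ cong (λ v → x * z * p * q + y * w * p′ * q′ + v + k)
           (cong₂ (λ s t → x * w * t + s * (p * q′)) eq (IsFarey.unimodular F)) ⟨
    x * z * p * q + y * w * p′ * q′ + (x * w * (p′ * q) + y * z * (p * q′)) + k
      ≡⟨ cong (_+ k) (solve 8 (λ p q p′ q′ x y z w → x :* z :* p :* q :+ y :* w :* p′ :* q′ :+ (x :* w :* (p′ :* q) :+ y :* z :* (p :* q′)) :=
           (z :* p :+ w :* p′) :* (x :* q :+ y :* q′)) refl p q p′ q′ x y z w) ⟩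
    (z * p + w * p′) * (x * q + y * q′) + k ∎

  size≤denominator : ∀ I {x y} → 0 < x → 0 < y → size I ≤ denominator I x y
  size≤denominator I 0<x 0<y = +-mono-≤ (m≤n*m′ 0<x) (m≤n*m′ 0<y)
    where
    m≤n*m′ : ∀ {m n} → 0 < n → m ≤ n * m
    m≤n*m′ {m} {suc n} _ = m≤m+n m (n * m)

  denominator≤size : ∀ I {x y M} → x ≤ M → y ≤ M → denominator I x y ≤ M * size I
  denominator≤size I {M = M} x≤M y≤M = begin
    _                        ≤⟨ +-mono-≤ (*-monoˡ-≤ (q I) x≤M) (*-monoˡ-≤ (q′ I) y≤M) ⟩
    M * q I + M * q′ I       ≡⟨ *-distribˡ-+ M (q I) (q′ I) ⟨
    M * size I               ∎

  0<size : ∀ {I} → IsFarey I → 0 < size I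
  0<size {I} F = ≤-trans (0<q F) (m≤m+n (q I) (q′ I))

  0<denominator : ∀ {I} → IsFarey I → ∀ {x y} → 0 < x → 0 < y → 0 < denominator I x y
  0<denominator {I} F 0<x 0<y = ≤-trans (0<size F) (size≤denominator I 0<x 0<y)

  step-farey : ∀ {m I} → IsMove m → IsFarey I → IsFarey (step m I)
  step-farey {m} {I} V F = record
    { unimodular = cross F (c m) (d m) (a m) (b m) (IsMove.unimodular V)
    ; 0<q        = 0<denominator F (0<a V) (0<b V)
    ; 0<q′       = 0<denominator F (0<c V) (0<d V)
    }

  -- Weights between 1 and `M` put both new denominators between `size I` and `M * size I`, whatever
  -- the shape of the parent, so imbalance cannot accumulate over the levels.
  step-balanced : ∀ {m M} I → IsMove m → Bounded M m → Balanced M (step m I)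
  step-balanced {m} {M} I V bd =
    ≤-trans (denominator≤size I (a≤ bd) (b≤ bd)) (*-monoʳ-≤ M (size≤denominator I (0<c V) (0<d V))) ,
    ≤-trans (denominator≤size I (c≤ bd) (d≤ bd)) (*-monoʳ-≤ M (size≤denominator I (0<a V) (0<b V)))

  -- The interval has width 1 / (q q′); this bounds it by a multiple of 1 / size², the scale in
  -- which levels are measured.
  balanced-size² : ∀ M I → Balanced M I → size I * size I ≤ suc M * suc M * (q I * q′ I)
  balanced-size² M I (q≤ , q′≤) = begin
    size I * size I                        ≤⟨ *-mono-≤ (+-monoʳ-≤ (q I) q′≤) (+-monoˡ-≤ (q′ I) q≤) ⟩
    suc M * q I * (M * q′ I + q′ I)        ≡⟨ solve 3 (λ m q r → (con 1 :+ m) :* q :* (m :* r :+ r) := (con 1 :+ m) :* (con 1 :+ m) :* (q :* r)) refl M (q I) (q′ I) ⟩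
    suc M * suc M * (q I * q′ I)           ∎

  size-growth : ∀ {m} I → IsMove m → 2 * size I ≤ size (step m I)
  size-growth {m} I V = begin
    2 * size I                             ≡⟨ cong (λ n → size I + n) (+-identityʳ (size I)) ⟩
    size I + size I                        ≤⟨ +-mono-≤ (size≤denominator I (0<a V) (0<b V)) (size≤denominator I (0<c V) (0<d V)) ⟩
    size (step m I)                        ∎

  size-bound : ∀ {m M} I → Bounded M m → size (step m I) ≤ 2 * M * size I
  size-bound {m} {M} I bd = begin
    size (step m I)                        ≤⟨ +-mono-≤ (denominator≤size I (a≤ bd) (b≤ bd)) (denominator≤size I (c≤ bd) (d≤ bd)) ⟩
    M * size I + M * size I                ≡⟨ solve 2 (λ m s → m :* s :+ m :* s := con 2 :* m :* s) refl M (size I) ⟩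
    2 * M * size I                         ∎

  q-increases : ∀ {m I} → IsMove m → IsFarey I → q I < q (step m I)
  q-increases {m} {I} V F = <-≤-trans (m<m+n (q I) (0<q′ F)) (size≤denominator I (0<a V) (0<b V))

  -- A fraction strictly inside a Farey interval has denominator at least q + q′,
  -- since s = q (p′ s − n q′) + q′ (n q − p s).
  outside : ∀ {I} → IsFarey I → ∀ {n s} → s < size I → n * q I ≤ p I * s ⊎ p′ I * s ≤ n * q′ I
  outside {interval p q p′ q′} F {n} {s} s<size with ≤-<-connex (n * q) (p * s) | ≤-<-connex (p′ * s) (n * q′)
  ... | inj₁ le | _       = inj₁ le
  ... | inj₂ _  | inj₁ le = inj₂ le
  ... | inj₂ l₁ | inj₂ l₂ = contradiction s<size (≤⇒≯ (+-cancelˡ-≤ (q * (n * q′) + q′ * (p * s)) (q + q′) s (begin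
    q * (n * q′) + q′ * (p * s) + (q + q′)
      ≡⟨ solve 5 (λ q q′ p n s → q :* (n :* q′) :+ q′ :* (p :* s) :+ (q :+ q′) :=
           q :* (con 1 :+ n :* q′) :+ q′ :* (con 1 :+ p :* s)) refl q q′ p n s ⟩
    q * suc (n * q′) + q′ * suc (p * s)        ≤⟨ +-mono-≤ (*-monoʳ-≤ q l₂) (*-monoʳ-≤ q′ l₁) ⟩
    q * (p′ * s) + q′ * (n * q)
      ≡⟨ solve 5 (λ q q′ p′ n s → q :* (p′ :* s) :+ q′ :* (n :* q) := p′ :* q :* s :+ q′ :* (n :* q)) refl q q′ p′ n s ⟩
    p′ * q * s + q′ * (n * q)                  ≡⟨ cong (λ t → t * s + q′ * (n * q)) (IsFarey.unimodular F) ⟩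
    (p * q′ + 1) * s + q′ * (n * q)
      ≡⟨ solve 5 (λ q q′ p n s → (p :* q′ :+ con 1) :* s :+ q′ :* (n :* q) := q :* (n :* q′) :+ q′ :* (p :* s) :+ s) refl q q′ p n s ⟩
    q * (n * q′) + q′ * (p * s) + s            ∎)))

  farey-coprime : ∀ {I} → IsFarey I → Coprime (p I) (q I)
  farey-coprime {I} F {i} (i∣p , i∣q) = ∣1⇒≡1 (∣m+n∣m⇒∣n (subst (i ∣_) (IsFarey.unimodular F) (∣n⇒∣m*n (p′ I) i∣q)) (∣m⇒∣m*n (q′ I) i∣p))

module CantorMeasure (em : ∀ {ℓ} → ExcludedMiddle ℓ) (R : CompleteOrderedField) where

  open CompleteOrderedField R renaming (Carrier to ℝ)
  open RealAnalysis R
  open CommutativeRing commutativeRing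
    using (_-_; semiring; ring; refl; sym; trans; +-cong; +-congˡ; +-congʳ; *-cong; *-congˡ; *-congʳ; -‿cong;
           +-identityˡ; +-identityʳ; *-identityˡ; *-identityʳ; +-comm; *-comm; *-assoc; +-assoc; zeroˡ; zeroʳ;
           -‿inverseʳ; distribˡ; distribʳ)
  open NonStrictToStrict _≈_ _≤_ using (_<_)
  open RawSemiringDefs (Semiring.rawSemiring semiring) using (_^_)
  open TotalOrder totalOrder using (poset; total; antisym; ≤-respˡ-≈; ≤-respʳ-≈)
    renaming (refl to ≤-refl; trans to ≤-trans; reflexive to ≤-reflexive)
  open Max totalOrder using (x≤x⊔y; x≤y⊔x; ⊔-lub)
  open Exp semiring using (^-assocʳ; ^-congˡ)
  open Mult semiring using (×-homo-+; ×1-homo-*)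
  open RingProperties ring using (-‿distribˡ-*; -‿distribʳ-*; -‿+-comm; -‿involutive; -0#≈0#)
  module ≤-Reasoning = PosetReasoning poset
  open ≤-Reasoning

  -- Integers in the field, and a ring solver with integer coefficients.

  fromℤ-⊖ : ∀ m n → fromℤ (m ⊖ n) ≈ fromℕ m - fromℕ n
  fromℤ-⊖ m       zero    = sym (trans (+-congˡ -0#≈0#) (+-identityʳ _))
  fromℤ-⊖ zero    (suc n) = sym (+-identityˡ _)
  fromℤ-⊖ (suc m) (suc n) = begin-equality
    fromℤ (suc m ⊖ suc n)             ≡⟨ ≡.cong fromℤ (ℤ.[1+m]⊖[1+n]≡m⊖n m n) ⟩
    fromℤ (m ⊖ n)                     ≈⟨ fromℤ-⊖ m n ⟩
    fromℕ m - fromℕ n                 ≈⟨ +-congʳ (+-identityʳ _) ⟨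
    fromℕ m + 0# - fromℕ n            ≈⟨ +-congʳ (+-congˡ (-‿inverseʳ 1#)) ⟨
    fromℕ m + (1# - 1#) - fromℕ n     ≈⟨ +-congʳ (+-assoc _ _ _) ⟨
    fromℕ m + 1# - 1# - fromℕ n       ≈⟨ +-congʳ (+-congʳ (+-comm _ _)) ⟩
    1# + fromℕ m - 1# - fromℕ n       ≈⟨ +-assoc _ _ _ ⟩
    1# + fromℕ m + (- 1# - fromℕ n)   ≈⟨ +-congˡ (-‿+-comm _ _) ⟩
    fromℕ (suc m) - fromℕ (suc n)     ∎

  fromℤ-◃+ : ∀ n → fromℤ (Sign.+ ◃ n) ≈ fromℕ n
  fromℤ-◃+ zero    = refl
  fromℤ-◃+ (suc n) = refl

  fromℤ-◃- : ∀ n → fromℤ (Sign.- ◃ n) ≈ - fromℕ n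
  fromℤ-◃- zero    = sym -0#≈0#
  fromℤ-◃- (suc n) = refl

  fromℤ-+ : ∀ i j → fromℤ (i ℤ.+ j) ≈ fromℤ i + fromℤ j
  fromℤ-+ (+ m)    (+ n)    = ×-homo-+ 1# m n
  fromℤ-+ (+ m)    -[1+ n ] = fromℤ-⊖ m (suc n)
  fromℤ-+ -[1+ m ] (+ n)    = trans (fromℤ-⊖ n (suc m)) (+-comm _ _)
  fromℤ-+ -[1+ m ] -[1+ n ] = begin-equality
    - fromℕ (suc (suc (m ℕ.+ n)))     ≡⟨ ≡.cong (λ k → - fromℕ (suc k)) (ℕ.+-suc m n) ⟨
    - fromℕ (suc m ℕ.+ suc n)         ≈⟨ -‿cong (×-homo-+ 1# (suc m) (suc n)) ⟩
    - (fromℕ (suc m) + fromℕ (suc n)) ≈⟨ -‿+-comm _ _ ⟨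
    - fromℕ (suc m) - fromℕ (suc n)   ∎

  fromℤ-* : ∀ i j → fromℤ (i ℤ.* j) ≈ fromℤ i * fromℤ j
  fromℤ-* (+ m)    (+ n)    = trans (fromℤ-◃+ (m ℕ.* n)) (×1-homo-* m n)
  fromℤ-* (+ m)    -[1+ n ] = trans (fromℤ-◃- (m ℕ.* suc n)) (trans (-‿cong (×1-homo-* m (suc n))) (-‿distribʳ-* _ _))
  fromℤ-* -[1+ m ] (+ n)    = trans (fromℤ-◃- (suc m ℕ.* n)) (trans (-‿cong (×1-homo-* (suc m) n)) (-‿distribˡ-* _ _))
  fromℤ-* -[1+ m ] -[1+ n ] = begin-equality
    fromℕ (suc m ℕ.* suc n)             ≈⟨ ×1-homo-* (suc m) (suc n) ⟩
    fromℕ (suc m) * fromℕ (suc n)       ≈⟨ -‿involutive _ ⟨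
    - - (fromℕ (suc m) * fromℕ (suc n)) ≈⟨ -‿cong (-‿distribˡ-* _ _) ⟩
    - (- fromℕ (suc m) * fromℕ (suc n)) ≈⟨ -‿distribʳ-* _ _ ⟩
    - fromℕ (suc m) * - fromℕ (suc n)   ∎

  fromℤ-neg : ∀ i → fromℤ (ℤ.- i) ≈ - fromℤ i
  fromℤ-neg (+ zero)  = sym -0#≈0#
  fromℤ-neg (+ suc n) = refl
  fromℤ-neg -[1+ n ]  = sym (-‿involutive _)

  -- The value at + 1 is 1# rather than fromℕ 1 = 1# + 0#, so that the solver's
  -- constant 1 is the field's.
  coefficient : ℤ → ℝ
  coefficient (+ 1) = 1#
  coefficient i     = fromℤ i

  coefficient≈ : ∀ i → coefficient i ≈ fromℤ i
  coefficient≈ (+ 0)           = refl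
  coefficient≈ (+ 1)           = sym (+-identityʳ 1#)
  coefficient≈ (+ suc (suc n)) = refl
  coefficient≈ -[1+ n ]        = refl

  coefficientMorphism : ℤ.+-*-rawRing -Raw-AlmostCommutative⟶ fromCommutativeRing commutativeRing
  coefficientMorphism = record
    { ⟦_⟧    = coefficient
    ; +-homo = λ i j → via (i ℤ.+ j) (trans (fromℤ-+ i j) (sym (+-cong (coefficient≈ i) (coefficient≈ j))))
    ; *-homo = λ i j → via (i ℤ.* j) (trans (fromℤ-* i j) (sym (*-cong (coefficient≈ i) (coefficient≈ j))))
    ; -‿homo = λ i → via (ℤ.- i) (trans (fromℤ-neg i) (sym (-‿cong (coefficient≈ i))))
    ; 0-homo = refl
    ; 1-homo = refl
    }
    where
    via : ∀ i {y} → fromℤ i ≈ y → coefficient i ≈ y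
    via i = trans (coefficient≈ i)

  coefficient-≟ : ∀ i j → Maybe (coefficient i ≈ coefficient j)
  coefficient-≟ i j with i ℤ.≟ j
  ... | yes ≡.refl = just refl
  ... | no _       = nothing

  open RingSolver ℤ.+-*-rawRing (fromCommutativeRing commutativeRing) coefficientMorphism coefficient-≟
    using (solve; _:=_; con; _:+_; _:*_; _:-_; :-_)

  -- Arithmetic of the ordered field.

  ≰⇒> : ∀ {x y} → ¬ (x ≤ y) → y < x
  ≰⇒> = NonStrictToStrict.≰⇒> _≈_ _≤_ sym ≤-reflexive total

  <⇒≱ : ∀ {x y} → x < y → ¬ (y ≤ x)
  <⇒≱ = NonStrictToStrict.<⇒≱ _≈_ _≤_ antisym

  <⇒≤ : ∀ {x y} → x < y → x ≤ y
  <⇒≤ = proj₁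

  ≤-<-trans : ∀ {x y z} → x ≤ y → y < z → x < z
  ≤-<-trans = NonStrictToStrict.≤-<-trans _≈_ _≤_ ≤-trans antisym ≤-respˡ-≈

  <-≤-trans : ∀ {x y z} → x < y → y ≤ z → x < z
  <-≤-trans = NonStrictToStrict.<-≤-trans _≈_ _≤_ sym ≤-trans antisym ≤-respʳ-≈

  ≤-or-> : ∀ x y → x ≤ y ⊎ y < x
  ≤-or-> x y with em {P = x ≤ y}
  ... | yes x≤y = inj₁ x≤y
  ... | no  x≰y = inj₂ (≰⇒> x≰y)

  ≮⇒≥ : ∀ {x y} → ¬ (x < y) → y ≤ x
  ≮⇒≥ {x} {y} x≮y with ≤-or-> y x
  ... | inj₁ y≤x = y≤x
  ... | inj₂ x<y = contradiction x<y x≮y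

  +-mono-≤ : ∀ {x y u v} → x ≤ y → u ≤ v → x + u ≤ y + v
  +-mono-≤ {x} {y} {u} {v} x≤y u≤v = begin
    x + u ≤⟨ +-monoˡ-≤ u x≤y ⟩
    y + u ≈⟨ +-comm y u ⟩
    u + y ≤⟨ +-monoˡ-≤ y u≤v ⟩
    v + y ≈⟨ +-comm v y ⟩
    y + v ∎

  +-monoʳ-≤ : ∀ z {x y} → x ≤ y → z + x ≤ z + y
  +-monoʳ-≤ z = +-mono-≤ ≤-refl

  x≤y⇒0≤y-x : ∀ {x y} → x ≤ y → 0# ≤ y - x
  x≤y⇒0≤y-x {x} {y} x≤y = begin
    0#    ≈⟨ -‿inverseʳ x ⟨
    x - x ≤⟨ +-monoˡ-≤ (- x) x≤y ⟩
    y - x ∎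

  0≤y-x⇒x≤y : ∀ {x y} → 0# ≤ y - x → x ≤ y
  0≤y-x⇒x≤y {x} {y} 0≤ = begin
    x           ≈⟨ +-identityˡ x ⟨
    0# + x      ≤⟨ +-monoˡ-≤ x 0≤ ⟩
    y - x + x   ≈⟨ solve 2 (λ x y → y :- x :+ x := y) refl x y ⟩
    y           ∎

  x+z≤y⇒x≤y-z : ∀ {x y z} → x + z ≤ y → x ≤ y - z
  x+z≤y⇒x≤y-z {x} {y} {z} p = 0≤y-x⇒x≤y (≤-respʳ-≈
    (solve 3 (λ x y z → y :- (x :+ z) := y :- z :- x) refl x y z) (x≤y⇒0≤y-x p))

  x≤y-z⇒x+z≤y : ∀ {x y z} → x ≤ y - z → x + z ≤ y
  x≤y-z⇒x+z≤y {x} {y} {z} p = 0≤y-x⇒x≤y (≤-respʳ-≈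
    (solve 3 (λ x y z → y :- z :- x := y :- (x :+ z)) refl x y z) (x≤y⇒0≤y-x p))

  +-cancelʳ-≤ : ∀ z {x y} → x + z ≤ y + z → x ≤ y
  +-cancelʳ-≤ z {x} {y} p = 0≤y-x⇒x≤y (≤-respʳ-≈
    (solve 3 (λ x y z → y :+ z :- (x :+ z) := y :- x) refl x y z) (x≤y⇒0≤y-x p))

  neg-mono-≤ : ∀ {x y} → x ≤ y → - y ≤ - x
  neg-mono-≤ {x} {y} p = 0≤y-x⇒x≤y (≤-respʳ-≈
    (solve 2 (λ x y → y :- x := (:- x) :- (:- y)) refl x y) (x≤y⇒0≤y-x p))

  *-monoʳ-≤ : ∀ {z x y} → 0# ≤ z → x ≤ y → z * x ≤ z * y
  *-monoʳ-≤ {z} {x} {y} 0≤z x≤y = 0≤y-x⇒x≤y (≤-respʳ-≈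
    (solve 3 (λ x y z → z :* (y :- x) := z :* y :- z :* x) refl x y z) (*-nonNegative 0≤z (x≤y⇒0≤y-x x≤y)))

  *-monoˡ-≤ : ∀ {z x y} → 0# ≤ z → x ≤ y → x * z ≤ y * z
  *-monoˡ-≤ {z} {x} {y} 0≤z x≤y = begin
    x * z ≈⟨ *-comm x z ⟩
    z * x ≤⟨ *-monoʳ-≤ 0≤z x≤y ⟩
    z * y ≈⟨ *-comm z y ⟩
    y * z ∎

  *-mono-≤ : ∀ {x y u v} → 0# ≤ x → 0# ≤ v → x ≤ y → u ≤ v → x * u ≤ y * v
  *-mono-≤ 0≤x 0≤v x≤y u≤v = ≤-trans (*-monoʳ-≤ 0≤x u≤v) (*-monoˡ-≤ 0≤v x≤y)

  0<1 : 0# < 1#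
  0<1 with total 0# 1#
  ... | inj₁ 0≤1 = 0≤1 , 0≉1
  ... | inj₂ 1≤0 = ≤-respʳ-≈ (solve 0 ((:- con (+ 1)) :* (:- con (+ 1)) := con (+ 1)) refl)
                     (*-nonNegative 0≤-1 0≤-1) , 0≉1
    where
    0≤-1 : 0# ≤ - 1#
    0≤-1 = ≤-respˡ-≈ -0#≈0# (neg-mono-≤ 1≤0)

  0≤1 : 0# ≤ 1#
  0≤1 = <⇒≤ 0<1

  >⇒≉0 : ∀ {x} → 0# < x → ¬ (x ≈ 0#)
  >⇒≉0 (_ , 0≉x) x≈0 = 0≉x (sym x≈0)

  x≤x+y : ∀ {x y} → 0# ≤ y → x ≤ x + y
  x≤x+y {x} 0≤y = ≤-respˡ-≈ (+-identityʳ x) (+-monoʳ-≤ x 0≤y)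

  +-nonNegative : ∀ {x y} → 0# ≤ x → 0# ≤ y → 0# ≤ x + y
  +-nonNegative 0≤x 0≤y = ≤-respˡ-≈ (+-identityˡ 0#) (+-mono-≤ 0≤x 0≤y)

  +-positiveˡ : ∀ {x y} → 0# < x → 0# ≤ y → 0# < x + y
  +-positiveˡ {x} {y} 0<x 0≤y = <-≤-trans 0<x (x≤x+y 0≤y)

  ⁻¹-inverse : ∀ {x} → 0# < x → x * x ⁻¹ ≈ 1#
  ⁻¹-inverse 0<x = ⁻¹-inverseʳ _ (>⇒≉0 0<x)

  ⁻¹-positive : ∀ {x} → 0# < x → 0# < x ⁻¹
  ⁻¹-positive {x} 0<x = 0≤x⁻¹ , λ 0≈x⁻¹ → 0≉1 (trans (sym (zeroʳ x)) (trans (*-congˡ 0≈x⁻¹) (⁻¹-inverse 0<x)))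
    where
    0≤x⁻¹ : 0# ≤ x ⁻¹
    0≤x⁻¹ with total 0# (x ⁻¹)
    ... | inj₁ p = p
    ... | inj₂ p = contradiction (≤-respˡ-≈ (⁻¹-inverse 0<x) (≤-respʳ-≈ (zeroʳ x) (*-monoʳ-≤ (<⇒≤ 0<x) p))) (<⇒≱ 0<1)

  *-cancelˡ-≤ : ∀ {z x y} → 0# < z → z * x ≤ z * y → x ≤ y
  *-cancelˡ-≤ {z} {x} {y} 0<z p = ≤-respˡ-≈ (unscale x) (≤-respʳ-≈ (unscale y) (*-monoʳ-≤ (<⇒≤ (⁻¹-positive 0<z)) p))
    where
    unscale : ∀ u → z ⁻¹ * (z * u) ≈ u
    unscale u = begin-equality
      z ⁻¹ * (z * u) ≈⟨ solve 3 (λ z i u → i :* (z :* u) := z :* i :* u) refl z (z ⁻¹) u ⟩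
      z * z ⁻¹ * u   ≈⟨ *-congʳ (⁻¹-inverse 0<z) ⟩
      1# * u         ≈⟨ *-identityˡ u ⟩
      u              ∎

  *-positive : ∀ {x y} → 0# < x → 0# < y → 0# < x * y
  *-positive {x} {y} 0<x 0<y = *-nonNegative (<⇒≤ 0<x) (<⇒≤ 0<y) ,
    λ 0≈xy → <⇒≱ 0<y (*-cancelˡ-≤ 0<x (≤-reflexive (trans (sym 0≈xy) (sym (zeroʳ x)))))

  *-monoʳ-< : ∀ {z x y} → 0# < z → x < y → z * x < z * y
  *-monoʳ-< 0<z x<y = ≰⇒> λ p → <⇒≱ x<y (*-cancelˡ-≤ 0<z p)

  +-monoˡ-< : ∀ z {x y} → x < y → x + z < y + z
  +-monoˡ-< z x<y = ≰⇒> λ p → <⇒≱ x<y (+-cancelʳ-≤ z p)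

  -- Natural numbers in the field, suprema and the archimedean property.

  fromℕ-+ : ∀ m n → fromℕ (m ℕ.+ n) ≈ fromℕ m + fromℕ n
  fromℕ-+ = ×-homo-+ 1#

  fromℕ-* : ∀ m n → fromℕ (m ℕ.* n) ≈ fromℕ m * fromℕ n
  fromℕ-* = ×1-homo-*

  fromℕ-nonNegative : ∀ n → 0# ≤ fromℕ n
  fromℕ-nonNegative zero    = ≤-refl
  fromℕ-nonNegative (suc n) = +-nonNegative 0≤1 (fromℕ-nonNegative n)

  fromℕ-positive : ∀ {n} → 0 ℕ.< n → 0# < fromℕ n
  fromℕ-positive {suc n} _ = +-positiveˡ 0<1 (fromℕ-nonNegative n)

  fromℕ-mono-≤ : ∀ {m n} → m ℕ.≤ n → fromℕ m ≤ fromℕ n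
  fromℕ-mono-≤ {n = n} z≤n = fromℕ-nonNegative n
  fromℕ-mono-≤ (s≤s m≤n)   = +-monoʳ-≤ 1# (fromℕ-mono-≤ m≤n)

  fromℕ-cancel-≤ : ∀ {m n} → fromℕ m ≤ fromℕ n → m ℕ.≤ n
  fromℕ-cancel-≤ {zero}          p = z≤n
  fromℕ-cancel-≤ {suc m} {zero}  p = contradiction p (<⇒≱ (fromℕ-positive {suc m} (s≤s z≤n)))
  fromℕ-cancel-≤ {suc m} {suc n} p = s≤s (fromℕ-cancel-≤ (+-cancelʳ-≤ 1# (≤-respˡ-≈ (+-comm _ _) (≤-respʳ-≈ (+-comm _ _) p))))

  ⨆-upperBound : ∀ (S : Pred ℝ _) {b} → IsUpperBound _≤_ S b → ∀ {x} → S x → x ≤ ⨆ S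
  ⨆-upperBound S {b} S≤b {x} x∈S = proj₁ (⨆-isSupremum S (x , x∈S) (b , S≤b)) x∈S

  ⨆-least : ∀ (S : Pred ℝ _) {x b} → S x → IsUpperBound _≤_ S b → ⨆ S ≤ b
  ⨆-least S {x} {b} x∈S S≤b = proj₂ (⨆-isSupremum S (x , x∈S) (b , S≤b)) b S≤b

  -- Otherwise the naturals are bounded with supremum `⨆ S`; as `n + 1` is below it for every `n`,
  -- the smaller `⨆ S - 1#` is an upper bound too.
  archimedean : ∀ x → ∃[ n ] x < fromℕ n
  archimedean x with em {P = ∃[ n ] x < fromℕ n}
  ... | yes p = p
  ... | no ¬p = contradiction (≤-respˡ-≈ (+-identityʳ _) 1+0≤0) (<⇒≱ 0<1)
    where
    S : Pred ℝ _
    S y = ∃[ n ] y ≈ fromℕ n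
    bounded : IsUpperBound _≤_ S x
    bounded {y} (n , y≈n) with ≤-or-> y x
    ... | inj₁ p = p
    ... | inj₂ p = ⊥-elim (¬p (n , <-≤-trans p (≤-reflexive y≈n)))
    shifted : IsUpperBound _≤_ S (⨆ S - 1#)
    shifted {y} (n , y≈n) = x+z≤y⇒x≤y-z (≤-respˡ-≈ (trans (+-comm 1# _) (+-congʳ (sym y≈n))) (⨆-upperBound S bounded (suc n , refl)))
    1+0≤0 : 1# + 0# ≤ 0#
    1+0≤0 = ≤-respˡ-≈ (solve 1 (λ s → s :+ con (+ 1) :- s := con (+ 1) :+ con (+ 0)) refl (⨆ S))
      (≤-respʳ-≈ (-‿inverseʳ (⨆ S)) (+-monoˡ-≤ (- ⨆ S) (x≤y-z⇒x+z≤y (⨆-least S (0 , refl) shifted))))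

  two : ℝ
  two = fromℕ 2

  0<two : 0# < two
  0<two = fromℕ-positive {2} (s≤s z≤n)

  0≤two : 0# ≤ two
  0≤two = <⇒≤ 0<two

  half : ℝ
  half = two ⁻¹

  0<half : 0# < half
  0<half = ⁻¹-positive 0<two

  0≤half : 0# ≤ half
  0≤half = <⇒≤ 0<half

  half+half : ∀ x → half * x + half * x ≈ x
  half+half x = begin-equality
    half * x + half * x ≈⟨ solve 2 (λ h x → h :* x :+ h :* x := con (+ 2) :* h :* x) refl half x ⟩
    two * half * x      ≈⟨ *-congʳ (⁻¹-inverse 0<two) ⟩
    1# * x              ≈⟨ *-identityˡ x ⟩
    x                   ∎

  half*x<x : ∀ {x} → 0# < x → half * x < x
  half*x<x {x} 0<x = begin-strict
    half * x              ≈⟨ +-identityˡ _ ⟨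
    0# + half * x         <⟨ +-monoˡ-< _ (*-positive 0<half 0<x) ⟩
    half * x + half * x   ≈⟨ half+half x ⟩
    x                     ∎

  ≤-approximation : ∀ {x y} → (∀ {δ} → 0# < δ → x ≤ y + δ) → x ≤ y
  ≤-approximation {x} {y} p with ≤-or-> x y
  ... | inj₁ x≤y = x≤y
  ... | inj₂ y<x = contradiction (p 0<δ) (<⇒≱ y+δ<x)
    where
    δ : ℝ
    δ = half * (x - y)
    0<x-y : 0# < x - y
    0<x-y = ≤-<-trans (≤-reflexive (sym (-‿inverseʳ y))) (+-monoˡ-< (- y) y<x)
    0<δ : 0# < δ
    0<δ = *-positive 0<half 0<x-y
    y+δ<x : y + δ < x
    y+δ<x = begin-strict
      y + δ       ≈⟨ solve 2 (λ y d → y :+ d := con (+ 0) :+ (y :+ d)) refl y δ ⟩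
      0# + (y + δ) <⟨ +-monoˡ-< (y + δ) 0<δ ⟩
      δ + (y + δ) ≈⟨ solve 2 (λ y d → d :+ (y :+ d) := y :+ (d :+ d)) refl y δ ⟩
      y + (δ + δ) ≈⟨ +-congˡ (half+half (x - y)) ⟩
      y + (x - y) ≈⟨ solve 2 (λ x y → y :+ (x :- y) := x) refl x y ⟩
      x           ∎

  -- Absolute values.

  ∣∣-lub : ∀ {x b} → x ≤ b → - x ≤ b → ∣ x ∣ ≤ b
  ∣∣-lub = ⊔-lub

  x≤∣x∣ : ∀ x → x ≤ ∣ x ∣
  x≤∣x∣ x = x≤x⊔y x (- x)

  -x≤∣x∣ : ∀ x → - x ≤ ∣ x ∣
  -x≤∣x∣ x = x≤y⊔x x (- x)

  ∣x-y∣≤ : ∀ {x y b} → x ≤ y + b → y ≤ x + b → ∣ x - y ∣ ≤ b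
  ∣x-y∣≤ {x} {y} {b} p q = ∣∣-lub
    (0≤y-x⇒x≤y (≤-respʳ-≈ (solve 3 (λ x y b → y :+ b :- x := b :- (x :- y)) refl x y b) (x≤y⇒0≤y-x p)))
    (0≤y-x⇒x≤y (≤-respʳ-≈ (solve 3 (λ x y b → x :+ b :- y := b :- (:- (x :- y))) refl x y b) (x≤y⇒0≤y-x q)))

  ∣x-y∣≤⇒x≤y+b : ∀ {x y b} → ∣ x - y ∣ ≤ b → x ≤ y + b
  ∣x-y∣≤⇒x≤y+b {x} {y} {b} p = 0≤y-x⇒x≤y (≤-respʳ-≈
    (solve 3 (λ x y b → b :- (x :- y) := y :+ b :- x) refl x y b) (x≤y⇒0≤y-x (≤-trans (x≤∣x∣ _) p)))

  ∣x-y∣≤⇒y≤x+b : ∀ {x y b} → ∣ x - y ∣ ≤ b → y ≤ x + b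
  ∣x-y∣≤⇒y≤x+b {x} {y} {b} p = 0≤y-x⇒x≤y (≤-respʳ-≈
    (solve 3 (λ x y b → b :- (:- (x :- y)) := x :+ b :- y) refl x y b) (x≤y⇒0≤y-x (≤-trans (-x≤∣x∣ _) p)))

  ∣x-y∣≤∣y-x∣ : ∀ x y → ∣ x - y ∣ ≤ ∣ y - x ∣
  ∣x-y∣≤∣y-x∣ x y = ∣x-y∣≤ (∣x-y∣≤⇒y≤x+b ≤-refl) (∣x-y∣≤⇒x≤y+b ≤-refl)

  ∣∣-triangle : ∀ x y z → ∣ x - z ∣ ≤ ∣ x - y ∣ + ∣ y - z ∣
  ∣∣-triangle x y z = ∣x-y∣≤
    (begin
      x                               ≤⟨ ∣x-y∣≤⇒x≤y+b ≤-refl ⟩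
      y + ∣ x - y ∣                   ≤⟨ +-monoˡ-≤ _ (∣x-y∣≤⇒x≤y+b ≤-refl) ⟩
      z + ∣ y - z ∣ + ∣ x - y ∣       ≈⟨ solve 3 (λ z a b → z :+ b :+ a := z :+ (a :+ b)) refl z _ _ ⟩
      z + (∣ x - y ∣ + ∣ y - z ∣)     ∎)
    (begin
      z                               ≤⟨ ∣x-y∣≤⇒y≤x+b ≤-refl ⟩
      y + ∣ y - z ∣                   ≤⟨ +-monoˡ-≤ _ (∣x-y∣≤⇒y≤x+b ≤-refl) ⟩
      x + ∣ x - y ∣ + ∣ y - z ∣       ≈⟨ +-assoc _ _ _ ⟩
      x + (∣ x - y ∣ + ∣ y - z ∣)     ∎)

  -- Fractions of natural numbers.

  opaque
    frac : ℕ → ℕ → ℝ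
    frac a b = fromℕ a * (fromℕ b) ⁻¹

    frac-defn : ∀ a b → frac a b ≡ fromℕ a * fromℕ b ⁻¹
    frac-defn a b = ≡.refl

    frac-nonNegative : ∀ a {b} → 0 ℕ.< b → 0# ≤ frac a b
    frac-nonNegative a 0<b = *-nonNegative (fromℕ-nonNegative a) (<⇒≤ (⁻¹-positive (fromℕ-positive 0<b)))

    frac-positive : ∀ {a b} → 0 ℕ.< a → 0 ℕ.< b → 0# < frac a b
    frac-positive 0<a 0<b = *-positive (fromℕ-positive 0<a) (⁻¹-positive (fromℕ-positive 0<b))

    frac-unique : ∀ {a b x} → 0 ℕ.< b → fromℕ b * x ≈ fromℕ a → x ≈ frac a b
    frac-unique {a} {b} {x} 0<b bx≈a = begin-equality
      x                           ≈⟨ *-identityˡ x ⟨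
      1# * x                      ≈⟨ *-congʳ (⁻¹-inverse (fromℕ-positive 0<b)) ⟨
      fromℕ b * fromℕ b ⁻¹ * x    ≈⟨ solve 3 (λ b i x → b :* i :* x := b :* x :* i) refl (fromℕ b) _ x ⟩
      fromℕ b * x * fromℕ b ⁻¹    ≈⟨ *-congʳ bx≈a ⟩
      frac a b                    ∎

    *-frac : ∀ a {b} → 0 ℕ.< b → fromℕ b * frac a b ≈ fromℕ a
    *-frac a {b} 0<b = begin-equality
      fromℕ b * frac a b               ≈⟨ solve 3 (λ a b i → b :* (a :* i) := a :* (b :* i)) refl (fromℕ a) (fromℕ b) _ ⟩
      fromℕ a * (fromℕ b * fromℕ b ⁻¹) ≈⟨ *-congˡ (⁻¹-inverse (fromℕ-positive 0<b)) ⟩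
      fromℕ a * 1#                     ≈⟨ solve 1 (λ a → a :* con (+ 1) := a) refl _ ⟩
      fromℕ a                          ∎

  -- The subtraction-free form of c / d - a / b = k / (b d). Fed by `cross`, it turns determinants
  -- into exact distances.
  frac-difference : ∀ {a b c d k} → 0 ℕ.< b → 0 ℕ.< d → c ℕ.* b ≡ a ℕ.* d ℕ.+ k →
                    frac a b + frac k (b ℕ.* d) ≈ frac c d
  frac-difference {a} {b} {c} {d} {k} 0<b 0<d eq = frac-unique 0<d (antisym
    (*-cancelˡ-≤ 0<B (≤-reflexive lhs)) (*-cancelˡ-≤ 0<B (≤-reflexive (sym lhs))))
    where
    0<B = fromℕ-positive 0<b
    x = frac a b
    y = frac k (b ℕ.* d)
    by : fromℕ b * fromℕ d * y ≈ fromℕ k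
    by = trans (*-congʳ (sym (fromℕ-* b d))) (*-frac k (ℕ.*-mono-≤ 0<b 0<d))
    lhs : fromℕ b * (fromℕ d * (x + y)) ≈ fromℕ b * fromℕ c
    lhs = begin-equality
      fromℕ b * (fromℕ d * (x + y))
        ≈⟨ solve 4 (λ b d x y → b :* (d :* (x :+ y)) := b :* x :* d :+ b :* d :* y) refl (fromℕ b) (fromℕ d) x y ⟩
      fromℕ b * x * fromℕ d + fromℕ b * fromℕ d * y ≈⟨ +-cong (*-congʳ (*-frac a 0<b)) by ⟩
      fromℕ a * fromℕ d + fromℕ k                   ≈⟨ +-congʳ (fromℕ-* a d) ⟨
      fromℕ (a ℕ.* d) + fromℕ k                     ≈⟨ fromℕ-+ (a ℕ.* d) k ⟨
      fromℕ (a ℕ.* d ℕ.+ k)                         ≡⟨ ≡.cong fromℕ eq ⟨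
      fromℕ (c ℕ.* b)                               ≈⟨ fromℕ-* c b ⟩
      fromℕ c * fromℕ b                             ≈⟨ *-comm _ _ ⟩
      fromℕ b * fromℕ c                             ∎

  frac-mono-≤ : ∀ {a b c d} → 0 ℕ.< b → 0 ℕ.< d → a ℕ.* d ℕ.≤ c ℕ.* b → frac a b ≤ frac c d
  frac-mono-≤ {a} {b} {c} {d} 0<b 0<d le = begin
    frac a b                                          ≈⟨ +-identityʳ _ ⟨
    frac a b + 0#                                     ≤⟨ +-monoʳ-≤ _ (frac-nonNegative _ (ℕ.*-mono-≤ 0<b 0<d)) ⟩
    frac a b + frac (c ℕ.* b ℕ.∸ a ℕ.* d) (b ℕ.* d)   ≈⟨ frac-difference 0<b 0<d (≡.sym (ℕ.m+[n∸m]≡n le)) ⟩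
    frac c d                                          ∎

  -- Powers, suprema of sequences and finite sums.

  ^-nonNegative : ∀ {x} n → 0# ≤ x → 0# ≤ x ^ n
  ^-nonNegative zero    0≤x = 0≤1
  ^-nonNegative (suc n) 0≤x = *-nonNegative 0≤x (^-nonNegative n 0≤x)

  ^-positive : ∀ {x} n → 0# < x → 0# < x ^ n
  ^-positive zero    0<x = 0<1
  ^-positive (suc n) 0<x = *-positive 0<x (^-positive n 0<x)

  ^-monoˡ-≤ : ∀ n {x y} → 0# ≤ x → x ≤ y → x ^ n ≤ y ^ n
  ^-monoˡ-≤ zero    0≤x x≤y = ≤-refl
  ^-monoˡ-≤ (suc n) 0≤x x≤y = *-mono-≤ 0≤x (^-nonNegative n (≤-trans 0≤x x≤y)) x≤y (^-monoˡ-≤ n 0≤x x≤y)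

  ^≤1 : ∀ n {x} → 0# ≤ x → x ≤ 1# → x ^ n ≤ 1#
  ^≤1 zero    0≤x x≤1 = ≤-refl
  ^≤1 (suc n) 0≤x x≤1 = ≤-respʳ-≈ (*-identityˡ 1#) (*-mono-≤ 0≤x 0≤1 x≤1 (^≤1 n 0≤x x≤1))

  ^-antimonoʳ-≤ : ∀ {x m n} → 0# ≤ x → x ≤ 1# → m ℕ.≤ n → x ^ n ≤ x ^ m
  ^-antimonoʳ-≤ {n = n} 0≤x x≤1 z≤n       = ^≤1 n 0≤x x≤1
  ^-antimonoʳ-≤ 0≤x x≤1 (s≤s m≤n) = *-monoʳ-≤ 0≤x (^-antimonoʳ-≤ 0≤x x≤1 m≤n)

  -- A discrete intermediate value principle. It selects the critical scale three times: the level
  -- matching a radius, the power of κ matching ε, and the level matching a denominator.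
  crossing : (Q : ℕ → Set) → Q 0 → ∀ n → ¬ Q n → ∃[ k ] Q k × ¬ Q (suc k)
  crossing Q Q0 zero    ¬Qn = contradiction Q0 ¬Qn
  crossing Q Q0 (suc n) ¬Qn with em {P = Q n}
  ... | yes Qn = n , Qn , ¬Qn
  ... | no ¬Q′ = crossing Q Q0 n ¬Q′

  limit : (ℕ → ℝ) → ℝ
  limit s = ⨆ (λ y → ∃[ n ] y ≈ s n)

  limit-upperBound : ∀ (s : ℕ → ℝ) {b} → (∀ n → s n ≤ b) → ∀ n → s n ≤ limit s
  limit-upperBound s s≤b n = ⨆-upperBound (λ y → ∃[ n ] y ≈ s n) (λ { (n , y≈) → ≤-respˡ-≈ (sym y≈) (s≤b n) }) (n , refl)

  limit-least : ∀ (s : ℕ → ℝ) {b} → (∀ n → s n ≤ b) → limit s ≤ b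
  limit-least s s≤b = ⨆-least (λ y → ∃[ n ] y ≈ s n) (0 , refl) (λ { (n , y≈) → ≤-respˡ-≈ (sym y≈) (s≤b n) })

  sum : (ℕ → ℝ) → ℕ → ℝ
  sum f zero    = 0#
  sum f (suc n) = sum f n + f n

  sum-mono-≤ : ∀ {f g} → (∀ k → f k ≤ g k) → ∀ n → sum f n ≤ sum g n
  sum-mono-≤ f≤g zero    = ≤-refl
  sum-mono-≤ f≤g (suc n) = +-mono-≤ (sum-mono-≤ f≤g n) (f≤g n)

  sum-nonNegative : ∀ {f} → (∀ k → 0# ≤ f k) → ∀ n → 0# ≤ sum f n
  sum-nonNegative 0≤f zero    = ≤-refl
  sum-nonNegative 0≤f (suc n) = +-nonNegative (sum-nonNegative 0≤f n) (0≤f n)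

  sum-monoʳ-≤ : ∀ {f} → (∀ k → 0# ≤ f k) → ∀ {m n} → m ℕ.≤ n → sum f m ≤ sum f n
  sum-monoʳ-≤ {f} 0≤f {m} m≤n = go (ℕ.≤⇒≤′ m≤n)
    where
    go : ∀ {n} → m ℕ.≤′ n → sum f m ≤ sum f n
    go (ℕ.≤′-reflexive ≡.refl) = ≤-refl
    go {suc n} (ℕ.≤′-step p)   = ≤-trans (go p) (x≤x+y (0≤f n))

  sum-+ : ∀ f g n → sum (λ k → f k + g k) n ≈ sum f n + sum g n
  sum-+ f g zero    = sym (+-identityˡ 0#)
  sum-+ f g (suc n) = trans (+-congʳ (sum-+ f g n))
    (solve 4 (λ a b c d → a :+ b :+ (c :+ d) := a :+ c :+ (b :+ d)) refl (sum f n) (sum g n) (f n) (g n))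

  double≈ : ∀ x → two * x ≈ x + x
  double≈ = solve 1 (λ x → con (+ 2) :* x := x :+ x) refl

  double-cancel-≤ : ∀ {x y} → x + x ≤ y + y → x ≤ y
  double-cancel-≤ p = *-cancelˡ-≤ 0<two (≤-respˡ-≈ (sym (double≈ _)) (≤-respʳ-≈ (sym (double≈ _)) p))

  half≤1 : half ≤ 1#
  half≤1 = ≤-trans (x≤x+y 0≤half) (≤-reflexive
    (trans (sym (double≈ half)) (⁻¹-inverse 0<two)))

  half*two^ : ∀ n → half ^ n * two ^ n ≈ 1#
  half*two^ zero    = *-identityˡ 1#
  half*two^ (suc n) = begin-equality
    half * half ^ n * (two * two ^ n)   ≈⟨ solve 4 (λ h p t q → h :* p :* (t :* q) := t :* h :* (p :* q)) refl half _ two _ ⟩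
    two * half * (half ^ n * two ^ n)   ≈⟨ *-cong (⁻¹-inverse 0<two) (half*two^ n) ⟩
    1# * 1#                             ≈⟨ *-identityˡ 1# ⟩
    1#                                  ∎

  1≤two^ : ∀ n → 1# ≤ two ^ n
  1≤two^ zero    = ≤-refl
  1≤two^ (suc n) = ≤-trans (1≤two^ n) (≤-respʳ-≈ (sym (double≈ _)) (x≤x+y (^-nonNegative n 0≤two)))

  two^-mono-≤ : ∀ {m n} → m ℕ.≤ n → two ^ m ≤ two ^ n
  two^-mono-≤ {n = n} z≤n = 1≤two^ n
  two^-mono-≤ (s≤s m≤n)   = *-monoʳ-≤ 0≤two (two^-mono-≤ m≤n)

  fromℕ≤two^ : ∀ n → fromℕ n ≤ two ^ n
  fromℕ≤two^ zero    = 0≤1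
  fromℕ≤two^ (suc n) = begin
    1# + fromℕ n         ≤⟨ +-mono-≤ (1≤two^ n) (fromℕ≤two^ n) ⟩
    two ^ n + two ^ n    ≈⟨ double≈ _ ⟨
    two * two ^ n        ∎

  fromℕ*half^≤1 : ∀ n → fromℕ n * half ^ n ≤ 1#
  fromℕ*half^≤1 n = ≤-respʳ-≈ (trans (*-comm _ _) (half*two^ n))
    (*-monoˡ-≤ (^-nonNegative n 0≤half) (fromℕ≤two^ n))

  half^-small : ∀ {δ} → 0# < δ → ∃[ n ] half ^ n < δ
  half^-small {δ} 0<δ = let n , δ⁻¹<n = archimedean (δ ⁻¹) in n , ≰⇒> λ δ≤ → <⇒≱ δ⁻¹<n (*-cancelˡ-≤ 0<δ (begin
    δ * fromℕ n           ≈⟨ *-comm _ _ ⟩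
    fromℕ n * δ           ≤⟨ *-monoʳ-≤ (fromℕ-nonNegative n) δ≤ ⟩
    fromℕ n * half ^ n    ≤⟨ fromℕ*half^≤1 n ⟩
    1#                    ≈⟨ ⁻¹-inverse 0<δ ⟨
    δ * δ ⁻¹              ∎))

  frac-* : ∀ a c {b d} → 0 ℕ.< b → 0 ℕ.< d → frac a b * frac c d ≈ frac (a ℕ.* c) (b ℕ.* d)
  frac-* a c {b} {d} 0<b 0<d = frac-unique (ℕ.*-mono-≤ 0<b 0<d) (begin-equality
    fromℕ (b ℕ.* d) * (frac a b * frac c d)        ≈⟨ *-congʳ (fromℕ-* b d) ⟩
    fromℕ b * fromℕ d * (frac a b * frac c d)
      ≈⟨ solve 4 (λ b d x y → b :* d :* (x :* y) := b :* x :* (d :* y)) refl (fromℕ b) (fromℕ d) _ _ ⟩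
    fromℕ b * frac a b * (fromℕ d * frac c d)      ≈⟨ *-cong (*-frac a 0<b) (*-frac c 0<d) ⟩
    fromℕ a * fromℕ c                              ≈⟨ fromℕ-* a c ⟨
    fromℕ (a ℕ.* c)                                ∎)

  frac-cancel-≤ : ∀ {a b c d} → 0 ℕ.< b → 0 ℕ.< d → frac a b ≤ frac c d → a ℕ.* d ℕ.≤ c ℕ.* b
  frac-cancel-≤ {a} {b} {c} {d} 0<b 0<d le = fromℕ-cancel-≤ {a ℕ.* d} {c ℕ.* b} (begin
    fromℕ (a ℕ.* d)                          ≈⟨ fromℕ-* a d ⟩
    fromℕ a * fromℕ d                        ≈⟨ *-congʳ (*-frac a 0<b) ⟨
    fromℕ b * frac a b * fromℕ d             ≈⟨ solve 3 (λ b d x → b :* x :* d := b :* d :* x) refl (fromℕ b) (fromℕ d) _ ⟩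
    fromℕ b * fromℕ d * frac a b             ≤⟨ *-monoʳ-≤ (*-nonNegative (fromℕ-nonNegative b) (fromℕ-nonNegative d)) le ⟩
    fromℕ b * fromℕ d * frac c d             ≈⟨ solve 3 (λ b d x → b :* d :* x := d :* x :* b) refl (fromℕ b) (fromℕ d) _ ⟩
    fromℕ d * frac c d * fromℕ b             ≈⟨ *-congʳ (*-frac c 0<d) ⟩
    fromℕ c * fromℕ b                        ≈⟨ fromℕ-* c b ⟨
    fromℕ (c ℕ.* b)                          ∎)

  frac-≤ : ∀ {a b x} → 0 ℕ.< b → fromℕ a ≤ fromℕ b * x → frac a b ≤ x
  frac-≤ 0<b le = *-cancelˡ-≤ (fromℕ-positive 0<b) (≤-trans (≤-reflexive (*-frac _ 0<b)) le)

  ≤-frac : ∀ {a b x} → 0 ℕ.< b → fromℕ b * x ≤ fromℕ a → x ≤ frac a b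
  ≤-frac 0<b le = *-cancelˡ-≤ (fromℕ-positive 0<b) (≤-trans le (≤-reflexive (sym (*-frac _ 0<b))))

  -- Outer measure on coin tosses

  Ω : Set
  Ω = ℕ → Bool

  infixr 5 _◂_
  _◂_ : Bool → Ω → Ω
  (b ◂ ω) zero    = b
  (b ◂ ω) (suc i) = ω i

  tail : Ω → Ω
  tail ω i = ω (suc i)

  prefix : ℕ → Ω → List Bool
  prefix zero    ω = []
  prefix (suc k) ω = ω 0 ∷ prefix k (tail ω)

  prefix-cong : ∀ k {ω ω′ : Ω} → (∀ i → ω i ≡ ω′ i) → prefix k ω ≡ prefix k ω′
  prefix-cong zero    eq = ≡.refl
  prefix-cong (suc k) eq = ≡.cong₂ _∷_ (eq 0) (prefix-cong k (λ i → eq (suc i)))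

  record IsSupermartingale (M : List Bool → ℝ) : Set where
    field
      nonNegative : ∀ w → 0# ≤ M w
      fair        : ∀ w → M (w ∷ʳ false) + M (w ∷ʳ true) ≤ M w + M w
  open IsSupermartingale

  -- The strategy as it continues after the first bit `b`. Bets concern the bit appended at the far
  -- end of the word, so fairness is inherited verbatim.
  shift : Bool → (List Bool → ℝ) → List Bool → ℝ
  shift b M w = M (b ∷ w)

  shift-supermartingale : ∀ b {M} → IsSupermartingale M → IsSupermartingale (shift b M)
  shift-supermartingale b sM = record
    { nonNegative = λ w → nonNegative sM (b ∷ w)
    ; fair        = λ w → fair sM (b ∷ w)
    }

  const-supermartingale : ∀ {c} → 0# ≤ c → IsSupermartingale (λ _ → c)
  const-supermartingale 0≤c = record { nonNegative = λ _ → 0≤c ; fair = λ _ → ≤-refl }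

  sum-supermartingale : ∀ {M : ℕ → List Bool → ℝ} → (∀ k → IsSupermartingale (M k)) →
                        ∀ n → IsSupermartingale (λ w → sum (λ k → M k w) n)
  sum-supermartingale sM zero = const-supermartingale ≤-refl
  sum-supermartingale {M} sM (suc n) = record
    { nonNegative = λ w → +-nonNegative (nonNegative ih w) (nonNegative (sM n) w)
    ; fair        = λ w → begin
        S (w ∷ʳ false) + M n (w ∷ʳ false) + (S (w ∷ʳ true) + M n (w ∷ʳ true)) ≈⟨ interchange _ _ _ _ ⟩
        S (w ∷ʳ false) + S (w ∷ʳ true) + (M n (w ∷ʳ false) + M n (w ∷ʳ true)) ≤⟨ +-mono-≤ (fair ih w) (fair (sM n) w) ⟩
        S w + S w + (M n w + M n w)                                           ≈⟨ interchange _ _ _ _ ⟩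
        S w + M n w + (S w + M n w)                                           ∎
    }
    where
    S : List Bool → ℝ
    S w = sum (λ k → M k w) n
    ih = sum-supermartingale sM n
    interchange : ∀ a b c d → a + b + (c + d) ≈ a + c + (b + d)
    interchange = solve 4 (λ a b c d → a :+ b :+ (c :+ d) := a :+ c :+ (b :+ d)) refl

  step-growth : ∀ {M} → IsSupermartingale M → ∀ b → M (b ∷ []) ≤ M [] + M []
  step-growth sM false = ≤-trans (x≤x+y (nonNegative sM _)) (fair sM [])
  step-growth sM true  = ≤-trans (≤-respˡ-≈ (+-identityˡ _) (+-monoˡ-≤ _ (nonNegative sM _))) (fair sM [])

  -- Capital can at most double with each bit. A bound on a series of strategies at the empty word
  -- thus bounds it at every word, which makes the suprema in `limit-supermartingale` meaningful.
  growth : ∀ {M} → IsSupermartingale M → ∀ w → M w ≤ two ^ length w * M []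
  growth {M} sM []      = ≤-reflexive (sym (*-identityˡ _))
  growth {M} sM (b ∷ w) = begin
    M (b ∷ w)                            ≤⟨ growth (shift-supermartingale b sM) w ⟩
    two ^ length w * M (b ∷ [])          ≤⟨ *-monoʳ-≤ (^-nonNegative (length w) 0≤two) (step-growth sM b) ⟩
    two ^ length w * (M [] + M [])       ≈⟨ solve 2 (λ t m → t :* (m :+ m) := con (+ 2) :* t :* m) refl _ _ ⟩
    two ^ suc (length w) * M []          ∎

  limit-supermartingale : ∀ {M : ℕ → List Bool → ℝ} → (∀ k → IsSupermartingale (M k)) →
                          ∀ {c} → (∀ n → sum (λ k → M k []) n ≤ c) →
                          IsSupermartingale (λ w → limit (sum (λ k → M k w)))
  limit-supermartingale {M} sM {c} ≤c = record
    { nonNegative = λ w → S≤limit w 0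
    -- The two suprema on the left are replaced by partial sums one at a time, with independent
    -- indices; monotonicity then brings both to the common index `n ⊔ m`, where the finite sum is
    -- fair.
    ; fair        = λ w → x≤y-z⇒x+z≤y (limit-least _ λ n → x+z≤y⇒x≤y-z
        (≤-respˡ-≈ (+-comm _ _) (x≤y-z⇒x+z≤y (limit-least _ λ m → x+z≤y⇒x≤y-z (begin
          S (w ∷ʳ true) m + S (w ∷ʳ false) n                         ≈⟨ +-comm _ _ ⟩
          S (w ∷ʳ false) n + S (w ∷ʳ true) m                         ≤⟨ +-mono-≤ (S-mono (w ∷ʳ false) (ℕ.m≤m⊔n n m)) (S-mono (w ∷ʳ true) (ℕ.m≤n⊔m n m)) ⟩
          S (w ∷ʳ false) (n ℕ.⊔ m) + S (w ∷ʳ true) (n ℕ.⊔ m)         ≤⟨ fair (sum-supermartingale sM (n ℕ.⊔ m)) w ⟩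
          S w (n ℕ.⊔ m) + S w (n ℕ.⊔ m)                              ≤⟨ +-mono-≤ (S≤limit w (n ℕ.⊔ m)) (S≤limit w (n ℕ.⊔ m)) ⟩
          limit (S w) + limit (S w)                                  ∎)))))
    }
    where
    S : List Bool → ℕ → ℝ
    S w = sum (λ k → M k w)
    S-mono : ∀ w {m n} → m ℕ.≤ n → S w m ≤ S w n
    S-mono w = sum-monoʳ-≤ (λ k → nonNegative (sM k) w)
    S≤limit : ∀ w n → S w n ≤ limit (S w)
    S≤limit w = limit-upperBound (S w) λ n → ≤-trans (growth (sum-supermartingale sM n) w)
      (*-monoʳ-≤ (^-nonNegative (length w) 0≤two) (≤c n))

  -- A gambler who bets on the bits of a fair coin starts with capital M [] and
  -- succeeds on every outcome in E when M covers E.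
  record Covers (M : List Bool → ℝ) (E : Pred Ω 0ℓ) : Set where
    field
      supermartingale : IsSupermartingale M
      succeeds        : ∀ ω → E ω → ∃[ k ] 1# ≤ M (prefix k ω)
  open Covers

  one-covers : ∀ E → Covers (λ _ → 1#) E
  one-covers E = record { supermartingale = const-supermartingale 0≤1 ; succeeds = λ _ _ → 0 , ≤-refl }

  -- The infimum of the prices is taken as the supremum of their lower bounds, since `⨆` is the form
  -- in which completeness is given.
  LowerPrice : Pred Ω 0ℓ → Pred ℝ 0ℓ
  LowerPrice E t = ∀ M → Covers M E → t ≤ M []

  opaque
    -- Ville's outer measure: the infimum of the initial capitals of the
    -- supermartingales covering E.
    outer : Pred Ω 0ℓ → ℝ
    outer E = ⨆ (LowerPrice E)

    outer-lower : ∀ {E M} → Covers M E → outer E ≤ M []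
    outer-lower {E} {M} cov = ⨆-least (LowerPrice E) {0#}
      (λ M cov → nonNegative (supermartingale cov) []) (λ p → p M cov)

    outer-greatest : ∀ {E t} → (∀ M → Covers M E → t ≤ M []) → t ≤ outer E
    outer-greatest {E} p = ⨆-upperBound (LowerPrice E) (λ q → q _ (one-covers E)) p

  outer-approximation : ∀ E {δ} → 0# < δ → ∃[ M ] Covers M E × M [] ≤ outer E + δ
  outer-approximation E {δ} 0<δ with em {P = ∃[ M ] Covers M E × M [] ≤ outer E + δ}
  ... | yes p = p
  ... | no ¬p = contradiction
    (+-cancelʳ-≤ (outer E) (≤-respˡ-≈ (+-comm _ _) (≤-respʳ-≈ (sym (+-identityˡ _))
      (outer-greatest λ M cov → <⇒≤ (≰⇒> λ q → ¬p (M , cov , q))))))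
    (<⇒≱ 0<δ)

  outer-nonNegative : ∀ E → 0# ≤ outer E
  outer-nonNegative E = outer-greatest λ M cov → nonNegative (supermartingale cov) []

  outer≤1 : ∀ E → outer E ≤ 1#
  outer≤1 E = outer-lower (one-covers E)

  outer-mono : ∀ {E F} → E ⊆ F → outer E ≤ outer F
  outer-mono E⊆F = outer-greatest λ M cov → outer-lower record
    { supermartingale = supermartingale cov ; succeeds = λ ω ω∈E → succeeds cov ω (E⊆F ω∈E) }

  outer-empty : ∀ {E} → (∀ ω → ¬ E ω) → outer E ≤ 0#
  outer-empty ¬E = outer-lower record
    { supermartingale = const-supermartingale ≤-refl ; succeeds = λ ω ω∈E → ⊥-elim (¬E ω ω∈E) }

  -- All the gamblers play at once: with covers that are optimal up to δ / 2^(k+1), the sum of the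
  -- capitals is a supermartingale of initial value at most `s + δ`, and it reaches 1 as soon as one
  -- summand does.
  outer-countable : ∀ (E : ℕ → Pred Ω 0ℓ) {s} → (∀ n → sum (λ k → outer (E k)) n ≤ s) →
                    outer (λ ω → ∃[ n ] E n ω) ≤ s
  outer-countable E {s} ≤s = ≤-approximation λ {δ} 0<δ → near 0<δ
    where
    module _ {δ} (0<δ : 0# < δ) where
      price : ℕ → ℝ
      price k = δ * half ^ suc k
      prices : ∀ n → sum price n + δ * half ^ n ≈ δ
      prices zero    = solve 1 (λ d → con (+ 0) :+ d :* con (+ 1) := d) refl δ
      prices (suc n) = begin-equality
        sum price n + δ * (half * half ^ n) + δ * (half * half ^ n)
          ≈⟨ solve 4 (λ s d h p → s :+ d :* (h :* p) :+ d :* (h :* p) := s :+ d :* (h :* p :+ h :* p)) refl _ δ half _ ⟩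
        sum price n + δ * (half * half ^ n + half * half ^ n)       ≈⟨ +-congˡ (*-congˡ (half+half _)) ⟩
        sum price n + δ * half ^ n                                  ≈⟨ prices n ⟩
        δ                                                           ∎
      cover : ∀ k → ∃[ M ] Covers M (E k) × M [] ≤ outer (E k) + price k
      cover k = outer-approximation (E k) (*-positive 0<δ (^-positive (suc k) 0<half))
      M : ℕ → List Bool → ℝ
      M k = proj₁ (cover k)
      M-covers : ∀ k → Covers (M k) (E k)
      M-covers k = proj₁ (proj₂ (cover k))
      M-super : ∀ k → IsSupermartingale (M k)
      M-super k = supermartingale (M-covers k)
      S : List Bool → ℕ → ℝ
      S w = sum (λ k → M k w)
      total-price : ∀ n → S [] n ≤ s + δ
      total-price n = begin
        S [] n                                       ≤⟨ sum-mono-≤ (λ k → proj₂ (proj₂ (cover k))) n ⟩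
        sum (λ k → outer (E k) + price k) n          ≈⟨ sum-+ (λ k → outer (E k)) price n ⟩
        sum (λ k → outer (E k)) n + sum price n      ≤⟨ +-mono-≤ (≤s n) (≤-respʳ-≈ (prices n)
          (≤-respˡ-≈ (+-identityʳ _) (+-monoʳ-≤ (sum price n) (*-nonNegative (<⇒≤ 0<δ) (^-nonNegative n 0≤half))))) ⟩
        s + δ                                        ∎
      S-bounded : ∀ w n → S w n ≤ two ^ length w * (s + δ)
      S-bounded w n = ≤-trans (growth (sum-supermartingale M-super n) w)
        (*-monoʳ-≤ (^-nonNegative (length w) 0≤two) (total-price n))
      near : outer (λ ω → ∃[ n ] E n ω) ≤ s + δ
      near = ≤-trans
        (outer-lower {M = λ w → limit (S w)} record
          { supermartingale = limit-supermartingale M-super total-price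
          ; succeeds        = λ { ω (n , ω∈E) →
              let k , 1≤ = succeeds (M-covers n) ω ω∈E
                  w = prefix k ω
              in k , (begin
                1#                    ≤⟨ 1≤ ⟩
                M n w                 ≈⟨ +-identityˡ _ ⟨
                0# + M n w            ≤⟨ +-monoˡ-≤ _ (sum-nonNegative (λ k → IsSupermartingale.nonNegative (M-super k) w) n) ⟩
                S w (suc n)           ≤⟨ limit-upperBound (S w) (S-bounded w) (suc n) ⟩
                limit (S w)           ∎) }
          })
        (limit-least (S []) total-price)

  -- The gambler can always be made to lose: one of the two bits does not
  -- increase the capital.
  unlucky : (List Bool → ℝ) → Ω
  unlucky-bit : (List Bool → ℝ) → Bool
  unlucky-bit M with total (M (false ∷ [])) (M (true ∷ []))
  ... | inj₁ _ = false
  ... | inj₂ _ = true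
  unlucky M zero    = unlucky-bit M
  unlucky M (suc n) = unlucky (shift (unlucky-bit M) M) n

  unlucky-bit-≤ : ∀ {M} → IsSupermartingale M → M (unlucky-bit M ∷ []) ≤ M []
  unlucky-bit-≤ {M} sM with total (M (false ∷ [])) (M (true ∷ []))
  ... | inj₁ p = double-cancel-≤ (≤-trans (+-monoʳ-≤ _ p) (fair sM []))
  ... | inj₂ p = double-cancel-≤ (≤-trans (+-monoˡ-≤ _ p) (fair sM []))

  unlucky-≤ : ∀ {M} → IsSupermartingale M → ∀ k → M (prefix k (unlucky M)) ≤ M []
  unlucky-≤ sM zero    = ≤-refl
  unlucky-≤ {M} sM (suc k) =
    ≤-trans (unlucky-≤ (shift-supermartingale (unlucky-bit M) sM) k) (unlucky-bit-≤ sM)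

  -- A strategy covering everything reaches 1 even along its unlucky sequence, where its capital
  -- never exceeds the initial one. This plays the part that compactness has for covers by
  -- cylinders.
  outer-U : ∀ {E : Pred Ω 0ℓ} → (∀ ω → E ω) → 1# ≤ outer E
  outer-U E = outer-greatest λ M cov →
    let k , 1≤ = succeeds cov (unlucky M) (E _) in ≤-trans 1≤ (unlucky-≤ (supermartingale cov) k)

  join : (Bool → List Bool → ℝ) → List Bool → ℝ
  join M []      = half * (M false [] + M true [])
  join M (b ∷ w) = M b w

  join-supermartingale : ∀ {M} → (∀ b → IsSupermartingale (M b)) → IsSupermartingale (join M)
  join-supermartingale sM = record
    { nonNegative = λ { []      → *-nonNegative 0≤half (+-nonNegative (nonNegative (sM false) []) (nonNegative (sM true) []))
                      ; (b ∷ w) → nonNegative (sM b) w }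
    ; fair        = λ { []      → ≤-reflexive (sym (half+half _))
                      ; (b ∷ w) → fair (sM b) w }
    }

  -- The mean of two capitals buys the right to continue, once the first bit is known, with the
  -- strategy for the corresponding section.
  outer-join : ∀ {E} (F : Bool → Pred Ω 0ℓ) → (∀ {ω} → E ω → F (ω 0) (tail ω)) →
               outer E + outer E ≤ outer (F false) + outer (F true)
  outer-join {E} F E⇒F = ≤-approximation λ {δ} 0<δ →
    let
      cover : ∀ b → ∃[ M ] Covers M (F b) × M [] ≤ outer (F b) + half * δ
      cover b = outer-approximation (F b) (*-positive 0<half 0<δ)
      M : Bool → List Bool → ℝ
      M b = proj₁ (cover b)
      covers : ∀ b → Covers (M b) (F b)
      covers b = proj₁ (proj₂ (cover b))
      joined : Covers (join M) E
      joined = record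
        { supermartingale = join-supermartingale λ b → supermartingale (covers b)
        ; succeeds        = λ ω ω∈E → let k , 1≤ = succeeds (covers (ω 0)) (tail ω) (E⇒F ω∈E) in suc k , 1≤
        }
    in begin
      outer E + outer E                                                   ≤⟨ +-mono-≤ (outer-lower joined) (outer-lower joined) ⟩
      join M [] + join M []                                               ≈⟨ half+half _ ⟩
      M false [] + M true []                                              ≤⟨ +-mono-≤ (proj₂ (proj₂ (cover false))) (proj₂ (proj₂ (cover true))) ⟩
      outer (F false) + half * δ + (outer (F true) + half * δ)
        ≈⟨ solve 3 (λ a b c → a :+ c :+ (b :+ c) := a :+ b :+ (c :+ c)) refl _ _ _ ⟩
      outer (F false) + outer (F true) + (half * δ + half * δ)            ≈⟨ +-congˡ (half+half δ) ⟩
      outer (F false) + outer (F true) + δ                                ∎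

  -- Converse to `outer-join`: a strategy for `E`, resumed after the bit `b`, covers the section
  -- `F b`.
  outer-split : ∀ {E} (F : Bool → Pred Ω 0ℓ) →
                (∀ b {ω} → F b ω → ∃[ ω′ ] E ω′ × ω′ 0 ≡ b × (∀ i → ω′ (suc i) ≡ ω i)) →
                outer (F false) + outer (F true) ≤ outer E + outer E
  outer-split {E} F F⇒E = ≤-respˡ-≈ (half+half _) (+-mono-≤ average average)
    where
    -- Success at the empty word would be lost by the shift. It is excluded here; in that case
    -- `M [] ≥ 1`, and the trivial bound `outer≤1` serves instead.
    covers : ∀ b {M} → Covers M E → ¬ (1# ≤ M []) → Covers (shift b M) (F b)
    covers b {M} cov 1≰ = record
      { supermartingale = shift-supermartingale b (supermartingale cov)
      ; succeeds        = λ ω ω∈F → let ω′ , ω′∈E , ω′0≡b , ω′≡ω = F⇒E b ω∈F in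
          advance ω′0≡b ω′≡ω (succeeds cov ω′ ω′∈E)
      }
      where
      advance : ∀ {ω ω′ : Ω} → ω′ 0 ≡ b → (∀ i → ω′ (suc i) ≡ ω i) →
                (∃[ k ] 1# ≤ M (prefix k ω′)) → ∃[ k ] 1# ≤ shift b M (prefix k ω)
      advance eq₀ eq (zero  , 1≤) = contradiction 1≤ 1≰
      advance eq₀ eq (suc k , 1≤) = k , ≡.subst (λ w → 1# ≤ M w) (≡.cong₂ _∷_ eq₀ (prefix-cong k eq)) 1≤
    average : half * (outer (F false) + outer (F true)) ≤ outer E
    average = outer-greatest λ M cov → double-cancel-≤ (≤-respˡ-≈ (sym (half+half _)) (bound M cov))
      where
      bound : ∀ M → Covers M E → outer (F false) + outer (F true) ≤ M [] + M []
      bound M cov with em {P = 1# ≤ M []}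
      ... | yes 1≤ = +-mono-≤ (≤-trans (outer≤1 _) 1≤) (≤-trans (outer≤1 _) 1≤)
      ... | no 1≰  = ≤-trans (+-mono-≤ (outer-lower (covers false cov 1≰)) (outer-lower (covers true cov 1≰)))
                             (fair (supermartingale cov) [])

  -- The measure of cylinders.

  Agree : ℕ → Ω → Pred Ω 0ℓ
  Agree n ω ω′ = ∀ i → i ℕ.< n → ω i ≡ ω′ i

  outer-branch-≤ : ∀ c (G : Pred Ω 0ℓ) →
                   outer (λ ω → c ≡ false × G ω) + outer (λ ω → c ≡ true × G ω) ≤ outer G
  outer-branch-≤ false G = ≤-respʳ-≈ (+-identityʳ _) (+-mono-≤ (outer-mono proj₂) (outer-empty λ { _ (() , _) }))
  outer-branch-≤ true  G = ≤-respʳ-≈ (+-identityˡ _) (+-mono-≤ (outer-empty λ { _ (() , _) }) (outer-mono proj₂))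

  outer-branch-≥ : ∀ c (G : Pred Ω 0ℓ) →
                   outer G ≤ outer (λ ω → c ≡ false × G ω) + outer (λ ω → c ≡ true × G ω)
  outer-branch-≥ false G = ≤-respˡ-≈ (+-identityʳ _) (+-mono-≤ (outer-mono (≡.refl ,_)) (outer-nonNegative _))
  outer-branch-≥ true  G = ≤-respˡ-≈ (+-identityˡ _) (+-mono-≤ (outer-nonNegative _) (outer-mono (≡.refl ,_)))

  cylinder-≤ : ∀ n ω → outer (Agree (suc n) ω) + outer (Agree (suc n) ω) ≤ outer (Agree n (tail ω))
  cylinder-≤ n ω = ≤-trans
    (outer-join (λ b ω′ → ω 0 ≡ b × Agree n (tail ω) ω′) λ p → p 0 (s≤s z≤n) , λ i i<n → p (suc i) (s≤s i<n))
    (outer-branch-≤ (ω 0) _)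

  cylinder-≥ : ∀ n ω → outer (Agree n (tail ω)) ≤ outer (Agree (suc n) ω) + outer (Agree (suc n) ω)
  cylinder-≥ n ω = ≤-trans (outer-branch-≥ (ω 0) _)
    (outer-split (λ b ω′ → ω 0 ≡ b × Agree n (tail ω) ω′) λ b {ω′} (eq , p) →
      (b ◂ ω′) , (λ { zero _ → eq ; (suc i) (s≤s i<n) → p i i<n }) , ≡.refl , λ _ → ≡.refl)

  -- A cylinder is refined at its last bit, whereas joining and splitting act on the first. The
  -- induction therefore peels first bits off both cylinders until only the last one remains.
  cylinder-halves : ∀ n ω → outer (Agree (suc n) ω) + outer (Agree (suc n) ω) ≤ outer (Agree n ω)
  cylinder-halves zero    ω = ≤-trans (cylinder-≤ zero ω) (outer-mono λ _ _ ())
  cylinder-halves (suc n) ω = double-cancel-≤ (begin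
    C + C + (C + C)                                        ≤⟨ +-mono-≤ (cylinder-≤ (suc n) ω) (cylinder-≤ (suc n) ω) ⟩
    outer (Agree (suc n) (tail ω)) + outer (Agree (suc n) (tail ω)) ≤⟨ cylinder-halves n (tail ω) ⟩
    outer (Agree n (tail ω))                               ≤⟨ cylinder-≥ n ω ⟩
    outer (Agree (suc n) ω) + outer (Agree (suc n) ω)      ∎)
    where C = outer (Agree (suc (suc n)) ω)

  cylinder-scaling : ∀ m n ω → two ^ m * outer (Agree (n ℕ.+ m) ω) ≤ outer (Agree n ω)
  cylinder-scaling zero    n ω = ≤-trans (≤-reflexive (*-identityˡ _))
    (outer-mono λ p i i<n → p i (ℕ.<-≤-trans i<n (ℕ.≤-reflexive (≡.sym (ℕ.+-identityʳ n)))))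
  cylinder-scaling (suc m) n ω = begin
    two ^ suc m * outer (Agree (n ℕ.+ suc m) ω)   ≡⟨ ≡.cong (λ k → two ^ suc m * outer (Agree k ω)) (ℕ.+-suc n m) ⟩
    two ^ suc m * outer (Agree (suc (n ℕ.+ m)) ω) ≈⟨ solve 2 (λ t x → con (+ 2) :* t :* x := t :* (x :+ x)) refl _ _ ⟩
    two ^ m * (outer (Agree (suc (n ℕ.+ m)) ω) + outer (Agree (suc (n ℕ.+ m)) ω))
      ≤⟨ *-monoʳ-≤ (^-nonNegative m 0≤two) (cylinder-halves (n ℕ.+ m) ω) ⟩
    two ^ m * outer (Agree (n ℕ.+ m) ω)           ≤⟨ cylinder-scaling m n ω ⟩
    outer (Agree n ω)                             ∎

  outer-head-positive : ∀ b → 0# < outer (λ ω → ω 0 ≡ b)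
  outer-head-positive b = ≰⇒> λ p → <⇒≱ 0<1 (begin
    1#                                                ≤⟨ outer-U (λ _ _ ()) ⟩
    outer (Agree 0 β)                                 ≤⟨ cylinder-≥ 0 β ⟩
    outer (Agree 1 β) + outer (Agree 1 β)             ≤⟨ +-mono-≤ (≤-trans (outer-mono λ q → ≡.sym (q 0 (s≤s z≤n))) p)
                                                                  (≤-trans (outer-mono λ q → ≡.sym (q 0 (s≤s z≤n))) p) ⟩
    0# + 0#                                           ≈⟨ +-identityˡ 0# ⟩
    0#                                                ∎)
    where
    β : Ω
    β _ = b

  -- Carathéodory measurability.

  -- Carathéodory's criterion, with its substantial inequality only; the reverse one is
  -- subadditivity.
  Measurable : Pred Ω 0ℓ → Set₁
  Measurable C = ∀ (E : Pred Ω 0ℓ) → outer (E ∩ C) + outer (E ∩ ∁ C) ≤ outer E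

  measurable-∁ : ∀ {C} → Measurable C → Measurable (∁ C)
  measurable-∁ {C} mC E = ≤-trans (≤-reflexive (+-comm _ _))
    (≤-trans (+-monoˡ-≤ _ (outer-mono λ (ω∈E , ¬¬C) → ω∈E , stable ¬¬C)) (mC E))
    where
    stable : ∀ {ω} → ¬ ¬ C ω → C ω
    stable {ω} ¬¬C with em {P = C ω}
    ... | yes p = p
    ... | no ¬p = contradiction ¬p ¬¬C

  measurable-resp : ∀ {C D} → C ⊆ D → D ⊆ C → Measurable C → Measurable D
  measurable-resp C⊆D D⊆C mC E = ≤-trans
    (+-mono-≤ (outer-mono λ (ω∈E , d) → ω∈E , D⊆C d) (outer-mono λ (ω∈E , ¬d) → ω∈E , λ c → ¬d (C⊆D c))) (mC E)

  module _ (A : ℕ → Pred Ω 0ℓ) (mA : ∀ n → Measurable (A n)) (E : Pred Ω 0ℓ) where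

    Remainder : ℕ → Pred Ω 0ℓ
    Remainder zero    = E
    Remainder (suc n) = Remainder n ∩ ∁ (A n)

    Piece : ℕ → Pred Ω 0ℓ
    Piece n = Remainder n ∩ A n

    -- The test set `Remainder n` is split by `A n` at each stage, and the splittings telescope.
    -- This yields additivity over the pieces although `E` is arbitrary.
    pieces+remainder : ∀ n → sum (λ k → outer (Piece k)) n + outer (Remainder n) ≤ outer E
    pieces+remainder zero    = ≤-reflexive (+-identityˡ _)
    pieces+remainder (suc n) = ≤-trans (≤-reflexive (+-assoc _ _ _))
      (≤-trans (+-monoʳ-≤ _ (mA n (Remainder n))) (pieces+remainder n))

    found-or-remains : ∀ n {ω} → E ω → (∃[ k ] Piece k ω) ⊎ Remainder n ω
    found-or-remains zero    ω∈E = inj₂ ω∈E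
    found-or-remains (suc n) {ω} ω∈E with found-or-remains n ω∈E | em {P = A n ω}
    ... | inj₁ p | _      = inj₁ p
    ... | inj₂ r | yes a  = inj₁ (n , r , a)
    ... | inj₂ r | no ¬a  = inj₂ (r , ¬a)

    ⋃⊆pieces : ∀ {ω} → E ω → (∃[ n ] A n ω) → ∃[ n ] Piece n ω
    ⋃⊆pieces ω∈E (n , a) with found-or-remains n ω∈E
    ... | inj₁ p = p
    ... | inj₂ r = n , r , a

    avoiding⊆remainder : ∀ n {ω} → E ω → (∀ k → k ℕ.< n → ¬ A k ω) → Remainder n ω
    avoiding⊆remainder zero    ω∈E ¬A = ω∈E
    avoiding⊆remainder (suc n) ω∈E ¬A =
      avoiding⊆remainder n ω∈E (λ k k<n → ¬A k (ℕ.m<n⇒m<1+n k<n)) , ¬A n (ℕ.n<1+n n)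

  -- Every remainder contains the part of `E` outside the union, so each partial sum over the pieces
  -- is at most `outer E` minus the measure of that part; countable subadditivity passes this bound
  -- to the union of the pieces.
  measurable-⋃ : ∀ {A : ℕ → Pred Ω 0ℓ} → (∀ n → Measurable (A n)) → Measurable (λ ω → ∃[ n ] A n ω)
  measurable-⋃ {A} mA E = x≤y-z⇒x+z≤y (≤-trans
    (outer-mono λ (ω∈E , a) → ⋃⊆pieces A mA E ω∈E a)
    (outer-countable (Piece A mA E) λ n → x+z≤y⇒x≤y-z (≤-trans
      (+-monoʳ-≤ _ (outer-mono λ (ω∈E , ¬a) → avoiding⊆remainder A mA E n ω∈E λ k _ a → ¬a (k , a)))
      (pieces+remainder A mA E n))))

  -- With the union itself as test set, disjointness places each `A k` inside its own piece.
  disjoint-sum-≤ : ∀ {A : ℕ → Pred Ω 0ℓ} → (∀ n → Measurable (A n)) →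
                   (∀ {i j ω} → i ≢ j → A i ω → ¬ A j ω) →
                   ∀ n → sum (λ k → outer (A k)) n ≤ outer (λ ω → ∃[ n ] A n ω)
  disjoint-sum-≤ {A} mA disjoint n = begin
    sum (λ k → outer (A k)) n                                        ≤⟨ sum-mono-≤ (λ k → outer-mono (A⊆piece k)) n ⟩
    sum (λ k → outer (Piece A mA E k)) n                             ≈⟨ +-identityʳ _ ⟨
    sum (λ k → outer (Piece A mA E k)) n + 0#                        ≤⟨ +-monoʳ-≤ _ (outer-nonNegative _) ⟩
    sum (λ k → outer (Piece A mA E k)) n + outer (Remainder A mA E n) ≤⟨ pieces+remainder A mA E n ⟩
    outer E                                                          ∎
    where
    E : Pred Ω 0ℓ
    E ω = ∃[ n ] A n ω
    A⊆piece : ∀ k {ω} → A k ω → Piece A mA E k ω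
    A⊆piece k a = avoiding⊆remainder A mA E k (k , a) (λ j j<k a′ → disjoint (ℕ.<⇒≢ j<k) a′ a) , a

  Determined : ℕ → Pred Ω 0ℓ → Set
  Determined n C = ∀ {ω ω′} → Agree n ω ω′ → C ω → C ω′

  -- Induction over sections by the first bit: `outer-join` takes the splitting problem to the
  -- sections and `outer-split` brings the answer back. A set determined by no bits is empty or
  -- everything.
  determined-measurable : ∀ n {C} → Determined n C → Measurable C
  determined-measurable zero {C} det E with em {P = ∃[ ω ] C ω}
  ... | yes (_ , c) = ≤-respʳ-≈ (+-identityʳ _) (+-mono-≤ (outer-mono proj₁) (outer-empty λ ω (_ , ¬c) → ¬c (det (λ _ ()) c)))
  ... | no ¬c       = ≤-respʳ-≈ (+-identityˡ _) (+-mono-≤ (outer-empty λ ω (_ , c) → ¬c (ω , c)) (outer-mono proj₁))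
  determined-measurable (suc n) {C} det E = double-cancel-≤ (begin
    o (E ∩ C) + o (E ∩ ∁ C) + (o (E ∩ C) + o (E ∩ ∁ C))
      ≈⟨ solve 2 (λ a b → a :+ b :+ (a :+ b) := a :+ a :+ (b :+ b)) refl _ _ ⟩
    o (E ∩ C) + o (E ∩ C) + (o (E ∩ ∁ C) + o (E ∩ ∁ C))
      ≤⟨ +-mono-≤ (outer-join (λ b → E′ b ∩ C′ b) λ {ω} (e , c) → (_ , e , ≡.refl , λ _ → ≡.refl) , det (λ i _ → retract ω i) c)
                  (outer-join (λ b → E′ b ∩ ∁ (C′ b)) λ {ω} (e , ¬c) →
                    (_ , e , ≡.refl , λ _ → ≡.refl) , λ c → ¬c (det (λ i _ → ≡.sym (retract ω i)) c)) ⟩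
    o (E′ false ∩ C′ false) + o (E′ true ∩ C′ true) + (o (E′ false ∩ ∁ (C′ false)) + o (E′ true ∩ ∁ (C′ true)))
      ≈⟨ solve 4 (λ a b c d → a :+ b :+ (c :+ d) := a :+ c :+ (b :+ d)) refl _ _ _ _ ⟩
    o (E′ false ∩ C′ false) + o (E′ false ∩ ∁ (C′ false)) + (o (E′ true ∩ C′ true) + o (E′ true ∩ ∁ (C′ true)))
      ≤⟨ +-mono-≤ (determined-measurable n (det′ false) (E′ false)) (determined-measurable n (det′ true) (E′ true)) ⟩
    o (E′ false) + o (E′ true)
      ≤⟨ outer-split E′ (λ b e → e) ⟩
    o E + o E ∎)
    where
    o = outer
    -- `E` is arbitrary and may distinguish pointwise equal sequences, so its section is closed
    -- under pointwise equality. `C` is determined, hence respects it, and its section can be formed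
    -- with `b ◂ ω` directly.
    E′ : Bool → Pred Ω 0ℓ
    E′ b ω = ∃[ ω′ ] E ω′ × ω′ 0 ≡ b × (∀ i → ω′ (suc i) ≡ ω i)
    C′ : Bool → Pred Ω 0ℓ
    C′ b ω = C (b ◂ ω)
    det′ : ∀ b → Determined n (C′ b)
    det′ b p = det λ { zero _ → ≡.refl ; (suc i) (s≤s i<n) → p i i<n }
    retract : ∀ (ω : Ω) i → ω i ≡ (ω 0 ◂ tail ω) i
    retract ω zero    = ≡.refl
    retract ω (suc i) = ≡.refl

  -- Decay of pushforward measures

  module Pushforward (Φ : Ω → ℝ)
    (Φ-continuous : ∀ ω {δ} → 0# < δ → ∃[ n ] (∀ ω′ → Agree n ω ω′ → ∣ Φ ω′ - Φ ω ∣ < δ))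
    where

    preimage : Pred ℝ 0ℓ → Pred Ω 0ℓ
    preimage A ω = A (Φ ω)

    -- By continuity the preimage of an open set is the union over `n` of the sets of sequences
    -- whose whole `n`-cylinder is mapped into it, and these are determined by `n` bits. The other
    -- Borel operations are those of measurable sets.
    borel-measurable : ∀ {A} → IsBorel A → Measurable (preimage A)
    borel-measurable (isOpen {V} openV) = measurable-resp
      (λ (n , p) → p _ (λ _ _ → ≡.refl))
      (λ {ω} v → let r , 0<r , ball = openV v
                     n , p = Φ-continuous ω 0<r
                 in n , λ ω′ agree → ball (p ω′ agree))
      (measurable-⋃ {A = λ n ω → ∀ ω′ → Agree n ω ω′ → V (Φ ω′)} λ n → determined-measurable n
        λ agree p ω″ agree′ → p ω″ λ i i<n → ≡.trans (agree i i<n) (agree′ i i<n))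
    borel-measurable (complement bA)          = measurable-∁ (borel-measurable bA)
    borel-measurable (union bA)               = measurable-⋃ (λ n → borel-measurable (bA n))
    borel-measurable (respects (A⊆ , ⊆A) bA)  = measurable-resp A⊆ ⊆A (borel-measurable bA)

    mass : Pred ℝ 0ℓ → ℝ
    mass A = outer (preimage A)

    partialSum-finite : ∀ f n → partialSum (λ k → [ f k ]) n ≡ [ sum f n ]
    partialSum-finite f zero = ≡.refl
    partialSum-finite f (suc n) rewrite partialSum-finite f n = ≡.refl

    pushforward : Measure
    pushforward = record
      { μ                 = λ A → [ mass A ]
      ; nonNegative       = λ _ → [ outer-nonNegative _ ]
      ; cong              = λ _ _ (A⊆ , ⊆A) → [ antisym (outer-mono A⊆) (outer-mono ⊆A) ]≈
      ; empty             = [ antisym (outer-empty λ _ ()) (outer-nonNegative _) ]≈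
      ; countablyAdditive = λ A bA disjoint →
          (λ { (n , ≡.refl) → ≡.subst (_≤⁺ _) (≡.sym (partialSum-finite _ n))
                 [ disjoint-sum-≤ (λ n → borel-measurable (bA n)) (λ i≢j a b → disjoint i≢j (a , b)) n ] }) ,
          λ { [ s ] ≤s → [ outer-countable _ (λ n → [≤]-injective _≤_ (≤s (n , ≡.sym (partialSum-finite _ n)))) ]
            ; ⊤⁺    ≤s → _ ≤⊤⁺ }
      ; locallyFinite     = λ x → 1# , 0<1 , 1# , [ outer≤1 _ ]
      }

  -- The number `half ^ n` is admissible in the supremum defining the real power, because p / q ≤ 1
  -- / s means p s ≤ q. The supremum is legitimate since the pair p = 0, q = 1 bounds the admissible
  -- set by 1.
  ^ʳ-lower : ∀ s n {x} → 0 ℕ.< s → 0# ≤ x → (half ^ s) ^ n ≤ x → half ^ n ≤ x ^ʳ (fromℕ s ⁻¹)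
  ^ʳ-lower s n {x} 0<s 0≤x κⁿ≤x = ⨆-upperBound S S≤1 (^-nonNegative n 0≤half , bound)
    where
    S : Pred ℝ 0ℓ
    S t = 0# ≤ t × (∀ (p q : ℕ) .{{_ : ℕ.NonZero q}} → fromℕ p * (fromℕ q) ⁻¹ ≤ fromℕ s ⁻¹ → t ^ q ≤ x ^ p)
    0<s⁻¹ : 0# < fromℕ s ⁻¹
    0<s⁻¹ = ⁻¹-positive (fromℕ-positive 0<s)
    S≤1 : IsUpperBound _≤_ S 1#
    S≤1 (0≤t , p) = ≤-respˡ-≈ (trans (*-comm _ _) (*-identityˡ _)) (p 0 1 (≤-trans (≤-reflexive (zeroˡ _)) (<⇒≤ 0<s⁻¹)))
    scale : ∀ p q → 0 ℕ.< q → fromℕ p * (fromℕ q) ⁻¹ ≤ fromℕ s ⁻¹ → p ℕ.* s ℕ.≤ q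
    scale p q 0<q le = fromℕ-cancel-≤ (begin
      fromℕ (p ℕ.* s)                               ≈⟨ fromℕ-* p s ⟩
      fromℕ p * fromℕ s                             ≈⟨ *-identityˡ _ ⟨
      1# * (fromℕ p * fromℕ s)                      ≈⟨ *-congʳ (⁻¹-inverse (fromℕ-positive 0<q)) ⟨
      fromℕ q * fromℕ q ⁻¹ * (fromℕ p * fromℕ s)    ≈⟨ solve 4 (λ p s q i → q :* i :* (p :* s) := q :* s :* (p :* i)) refl (fromℕ p) (fromℕ s) (fromℕ q) _ ⟩
      fromℕ q * fromℕ s * (fromℕ p * fromℕ q ⁻¹)    ≤⟨ *-monoʳ-≤ (*-nonNegative (fromℕ-nonNegative q) (fromℕ-nonNegative s)) le ⟩
      fromℕ q * fromℕ s * fromℕ s ⁻¹                ≈⟨ *-assoc _ _ _ ⟩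
      fromℕ q * (fromℕ s * fromℕ s ⁻¹)              ≈⟨ *-congˡ (⁻¹-inverse (fromℕ-positive 0<s)) ⟩
      fromℕ q * 1#                                  ≈⟨ trans (*-comm _ _) (*-identityˡ _) ⟩
      fromℕ q                                       ∎)
    bound : ∀ (p q : ℕ) .{{_ : ℕ.NonZero q}} → fromℕ p * (fromℕ q) ⁻¹ ≤ fromℕ s ⁻¹ → (half ^ n) ^ q ≤ x ^ p
    bound p q le = begin
      (half ^ n) ^ q             ≤⟨ ^-antimonoʳ-≤ (^-nonNegative n 0≤half) (^≤1 n 0≤half half≤1) (scale p q (ℕ.>-nonZero⁻¹ q) le) ⟩
      (half ^ n) ^ (p ℕ.* s)     ≈⟨ ^-assocʳ half n (p ℕ.* s) ⟩
      half ^ (n ℕ.* (p ℕ.* s))   ≡⟨ ≡.cong (half ^_) (+-*-Solver.solve 3 (λ n p s → n ℕS.:* (p ℕS.:* s) ℕS.:= (s ℕS.:* n) ℕS.:* p) ≡.refl n p s) ⟩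
      half ^ ((s ℕ.* n) ℕ.* p)   ≈⟨ ^-assocʳ half (s ℕ.* n) p ⟨
      (half ^ (s ℕ.* n)) ^ p     ≈⟨ ^-congˡ p (^-assocʳ half s n) ⟨
      ((half ^ s) ^ n) ^ p       ≤⟨ ^-monoˡ-≤ p (^-nonNegative n (^-nonNegative s 0≤half)) κⁿ≤x ⟩
      x ^ p                      ∎
      where module ℕS = +-*-Solver

  -- e ω n plays the role of the diameter of the level-n piece around Φ ω.
  record CantorScheme : Set where
    field
      Φ         : Ω → ℝ
      e         : Ω → ℕ → ℝ
      s         : ℕ
      2≤s       : 2 ℕ.≤ s
    κ : ℝ
    κ = half ^ s
    field
      e-root    : ∀ ω → 1# ≤ e ω 0
      e-small   : ∀ ω {δ} → 0# < δ → ∃[ n ] e ω n ≤ δ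
      e-ratio   : ∀ ω n → κ * e ω n ≤ e ω (suc n)
      close     : ∀ n {ω ω′} → Agree n ω ω′ → ∣ Φ ω - Φ ω′ ∣ ≤ e ω n
      separated : ∀ n {ω ω′} → ∣ Φ ω - Φ ω′ ∣ < κ * e ω n → Agree (suc n) ω ω′

  module Decay (scheme : CantorScheme) where
    open CantorScheme scheme

    0<s : 0 ℕ.< s
    0<s = ℕ.≤-trans (s≤s z≤n) 2≤s

    0<κ : 0# < κ
    0<κ = ^-positive s 0<half

    κ≤half : κ ≤ half
    κ≤half = ≤-trans (^-antimonoʳ-≤ {half} {1} 0≤half half≤1 0<s) (≤-reflexive (trans (*-comm _ _) (*-identityˡ _)))

    κ≤1 : κ ≤ 1#
    κ≤1 = ≤-trans κ≤half half≤1

    4κ≤1 : two * (two * κ) ≤ 1#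
    4κ≤1 = begin
      two * (two * half ^ s)   ≤⟨ *-monoʳ-≤ 0≤two (*-monoʳ-≤ 0≤two (^-antimonoʳ-≤ {half} {2} 0≤half half≤1 2≤s)) ⟩
      two * (two * half ^ 2)   ≈⟨ solve 2 (λ t p → t :* (t :* p) := p :* (t :* (t :* con (+ 1)))) refl two (half ^ 2) ⟩
      half ^ 2 * two ^ 2       ≈⟨ half*two^ 2 ⟩
      1#                       ∎

    continuous : ∀ ω {δ} → 0# < δ → ∃[ n ] (∀ ω′ → Agree n ω ω′ → ∣ Φ ω′ - Φ ω ∣ < δ)
    continuous ω {δ} 0<δ = let n , e≤ = e-small ω (*-positive 0<half 0<δ) in n , λ ω′ agree →
      ≤-<-trans (≤-trans (∣x-y∣≤∣y-x∣ _ _) (≤-trans (close n agree) e≤)) (half*x<x 0<δ)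

    open Pushforward Φ continuous public

    e-ratios : ∀ ω k m → κ ^ m * e ω k ≤ e ω (k ℕ.+ m)
    e-ratios ω k zero    = ≤-reflexive (trans (*-identityˡ _) (reflexive-≡ (≡.cong (e ω) (≡.sym (ℕ.+-identityʳ k)))))
      where
      reflexive-≡ : ∀ {x y} → x ≡ y → x ≈ y
      reflexive-≡ ≡.refl = refl
    e-ratios ω k (suc m) = begin
      κ * κ ^ m * e ω k       ≈⟨ *-assoc _ _ _ ⟩
      κ * (κ ^ m * e ω k)     ≤⟨ *-monoʳ-≤ (<⇒≤ 0<κ) (e-ratios ω k m) ⟩
      κ * e ω (k ℕ.+ m)       ≤⟨ e-ratio ω (k ℕ.+ m) ⟩
      e ω (suc (k ℕ.+ m))     ≡⟨ ≡.cong (e ω) (ℕ.+-suc k m) ⟨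
      e ω (k ℕ.+ suc m)       ∎

    -- The first scale not above ρ: one step earlier `e` exceeds ρ, and a step shrinks it by no more
    -- than κ.
    e-scale : ∀ ω {ρ} → 0# < ρ → ρ < 1# → ∃[ k ] e ω k ≤ ρ × κ * ρ ≤ e ω k
    e-scale ω {ρ} 0<ρ ρ<1 =
      let N , eN≤ρ = e-small ω 0<ρ
          k , ρ<ek , ρ≮ = crossing (λ k → ρ < e ω k) (<-≤-trans ρ<1 (e-root ω)) N (λ ρ<eN → <⇒≱ ρ<eN eN≤ρ)
      in suc k , ≮⇒≥ ρ≮ , ≤-trans (*-monoʳ-≤ (<⇒≤ 0<κ) (<⇒≤ ρ<ek)) (e-ratio ω k)

    -- If the small ball meets the set at Φ ω, the large ball contains a cylinder of some level `k`
    -- around ω, of diameter at most r / 2, while separation confines the small ball to the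
    -- subcylinder of level `k + m`, which is 2^m times lighter. Of the three spare factors κ in the
    -- bound on ε, one absorbs a factor 4, one the loss in `e-scale`, and one is the threshold in
    -- `separated`.
    ball-scaling : ∀ x {r ε} m → 0# < r → r ≤ 1# → 0# < ε → ε ≤ κ ^ (3 ℕ.+ m) →
                   two ^ m * mass (B x (ε * r)) ≤ mass (B x r)
    ball-scaling x {r} {ε} m 0<r r≤1 0<ε ε≤ with em {P = ∃[ ω ] B x (ε * r) (Φ ω)}
    ... | no ¬ω = ≤-trans (*-monoʳ-≤ (^-nonNegative m 0≤two) (outer-empty λ ω p → ¬ω (ω , p)))
                    (≤-trans (≤-reflexive (zeroʳ _)) (outer-nonNegative _))
    ... | yes (ω , near) = begin
      two ^ m * mass (B x (ε * r))             ≤⟨ *-monoʳ-≤ (^-nonNegative m 0≤two) (outer-mono small⊆) ⟩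
      two ^ m * outer (Agree (k ℕ.+ m) ω)      ≤⟨ cylinder-scaling m k ω ⟩
      outer (Agree k ω)                        ≤⟨ outer-mono ⊆large ⟩
      mass (B x r)                             ∎
      where
      ρ : ℝ
      ρ = half * r
      0<ρ : 0# < ρ
      0<ρ = *-positive 0<half 0<r
      ρ<1 : ρ < 1#
      ρ<1 = <-≤-trans (half*x<x 0<r) r≤1
      scale = e-scale ω 0<ρ ρ<1
      k = proj₁ scale
      4ε≤κ² : two * (two * ε) ≤ κ ^ (2 ℕ.+ m)
      4ε≤κ² = begin
        two * (two * ε)                      ≤⟨ *-monoʳ-≤ 0≤two (*-monoʳ-≤ 0≤two ε≤) ⟩
        two * (two * (κ * κ ^ (2 ℕ.+ m)))    ≈⟨ solve 3 (λ t k p → t :* (t :* (k :* p)) := t :* (t :* k) :* p) refl two κ _ ⟩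
        two * (two * κ) * κ ^ (2 ℕ.+ m)      ≤⟨ *-monoˡ-≤ (^-nonNegative (2 ℕ.+ m) (<⇒≤ 0<κ)) 4κ≤1 ⟩
        1# * κ ^ (2 ℕ.+ m)                   ≈⟨ *-identityˡ _ ⟩
        κ ^ (2 ℕ.+ m)                        ∎
      2ε≤1 : two * ε ≤ 1#
      2ε≤1 = ≤-trans (≤-respʳ-≈ (sym (double≈ _)) (x≤x+y (*-nonNegative 0≤two (<⇒≤ 0<ε))))
               (≤-trans 4ε≤κ² (^≤1 (2 ℕ.+ m) (<⇒≤ 0<κ) κ≤1))
      εr≤ρ : ε * r ≤ ρ
      εr≤ρ = *-monoˡ-≤ (<⇒≤ 0<r) (*-cancelˡ-≤ 0<two (≤-respʳ-≈ (sym (⁻¹-inverse 0<two)) 2ε≤1))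
      ⊆large : Agree k ω ⊆ preimage (B x r)
      ⊆large {ω′} agree = ≤-<-trans (∣∣-triangle (Φ ω′) (Φ ω) x) (begin-strict
        ∣ Φ ω′ - Φ ω ∣ + ∣ Φ ω - x ∣  ≤⟨ +-monoˡ-≤ _ (≤-trans (∣x-y∣≤∣y-x∣ _ _) (≤-trans (close k agree) (proj₁ (proj₂ scale)))) ⟩
        ρ + ∣ Φ ω - x ∣               ≈⟨ +-comm _ _ ⟩
        ∣ Φ ω - x ∣ + ρ               <⟨ +-monoˡ-< ρ near ⟩
        ε * r + ρ                     ≤⟨ +-monoˡ-≤ ρ εr≤ρ ⟩
        ρ + ρ                         ≈⟨ half+half r ⟩
        r                             ∎)
      gap : two * (ε * r) ≤ κ * e ω (k ℕ.+ m)
      gap = *-cancelˡ-≤ 0<two (begin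
        two * (two * (ε * r))         ≈⟨ solve 3 (λ t e r → t :* (t :* (e :* r)) := t :* (t :* e) :* r) refl two ε r ⟩
        two * (two * ε) * r           ≤⟨ *-monoˡ-≤ (<⇒≤ 0<r) 4ε≤κ² ⟩
        κ * (κ * κ ^ m) * r           ≈⟨ *-congˡ (half+half r) ⟨
        κ * (κ * κ ^ m) * (ρ + ρ)     ≈⟨ solve 3 (λ k p r → k :* (k :* p) :* (r :+ r) := con (+ 2) :* (k :* (p :* (k :* r)))) refl κ (κ ^ m) ρ ⟩
        two * (κ * (κ ^ m * (κ * ρ))) ≤⟨ *-monoʳ-≤ 0≤two (*-monoʳ-≤ (<⇒≤ 0<κ) (≤-trans
                                          (*-monoʳ-≤ (^-nonNegative m (<⇒≤ 0<κ)) (proj₂ (proj₂ scale))) (e-ratios ω k m))) ⟩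
        two * (κ * e ω (k ℕ.+ m))     ∎)
      small⊆ : preimage (B x (ε * r)) ⊆ Agree (k ℕ.+ m) ω
      small⊆ {ω′} near′ i i<k+m = separated (k ℕ.+ m) (<-≤-trans (begin-strict
        ∣ Φ ω - Φ ω′ ∣                ≤⟨ ∣∣-triangle (Φ ω) x (Φ ω′) ⟩
        ∣ Φ ω - x ∣ + ∣ x - Φ ω′ ∣    <⟨ +-monoˡ-< _ near ⟩
        ε * r + ∣ x - Φ ω′ ∣          ≤⟨ +-monoʳ-≤ _ (≤-trans (∣x-y∣≤∣y-x∣ _ _) (<⇒≤ near′)) ⟩
        ε * r + ε * r                 ≈⟨ double≈ _ ⟨
        two * (ε * r)                 ∎) gap) i (ℕ.m<n⇒m<1+n i<k+m)

    ball-mono : ∀ x {r ε} → 0# < r → ε ≤ 1# → mass (B x (ε * r)) ≤ mass (B x r)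
    ball-mono x {r} 0<r ε≤1 = outer-mono λ p → <-≤-trans p (≤-respʳ-≈ (*-identityˡ r) (*-monoˡ-≤ (<⇒≤ 0<r) ε≤1))

    absolutelyDecaying : IsAbsolutelyDecaying pushforward
    -- The exponent 1 / s turns κ^n into 2^-n. Of the constant 2^4, three factors pay for the levels
    -- lost in `ball-scaling` and one for rounding ε to a power of κ.
    absolutelyDecaying = fromℕ s ⁻¹ , ⁻¹-positive (fromℕ-positive 0<s) , two ^ 4 , ^-positive 4 0<two ,
      λ x r ε 0<r r≤1 0<ε ε≤1 → [ decay x 0<r r≤1 0<ε ε≤1 ]
      where
      κ^≤half^ : ∀ n → κ ^ n ≤ half ^ n
      κ^≤half^ n = ^-monoˡ-≤ n (<⇒≤ 0<κ) κ≤half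

      scaling-early : ∀ x {r ε} n → n ℕ.≤ 3 → 0# < r → ε ≤ 1# →
                      two ^ n * mass (B x (ε * r)) ≤ two ^ 3 * mass (B x r)
      scaling-early x n n≤3 0<r ε≤1 =
        *-mono-≤ (<⇒≤ (^-positive n 0<two)) (outer-nonNegative _) (two^-mono-≤ {n} {3} n≤3) (ball-mono x 0<r ε≤1)

      scaling : ∀ x {r ε} n → 0# < r → r ≤ 1# → 0# < ε → ε ≤ 1# → ε ≤ κ ^ n →
                two ^ n * mass (B x (ε * r)) ≤ two ^ 3 * mass (B x r)
      scaling x 0 0<r r≤1 0<ε ε≤1 ε≤ = scaling-early x 0 z≤n 0<r ε≤1
      scaling x 1 0<r r≤1 0<ε ε≤1 ε≤ = scaling-early x 1 (s≤s z≤n) 0<r ε≤1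
      scaling x 2 0<r r≤1 0<ε ε≤1 ε≤ = scaling-early x 2 (s≤s (s≤s z≤n)) 0<r ε≤1
      scaling x {r} {ε} (suc (suc (suc m))) 0<r r≤1 0<ε ε≤1 ε≤ = begin
        two * (two * (two * two ^ m)) * mass (B x (ε * r))
          ≈⟨ solve 3 (λ t p y → t :* (t :* (t :* p)) :* y := t :* (t :* (t :* con (+ 1))) :* (p :* y)) refl two (two ^ m) _ ⟩
        two ^ 3 * (two ^ m * mass (B x (ε * r)))   ≤⟨ *-monoʳ-≤ (<⇒≤ (^-positive 3 0<two)) (ball-scaling x m 0<r r≤1 0<ε ε≤) ⟩
        two ^ 3 * mass (B x r)                     ∎

      decay : ∀ x {r ε} → 0# < r → r ≤ 1# → 0# < ε → ε ≤ 1# →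
              mass (B x (ε * r)) ≤ two ^ 4 * ε ^ʳ fromℕ s ⁻¹ * mass (B x r)
      decay x {r} {ε} 0<r r≤1 0<ε ε≤1 =
        let N , half^N<ε = half^-small 0<ε
            n , ε≤κⁿ , ε≰ = crossing (λ n → ε ≤ κ ^ n) ε≤1 N λ ε≤ → <⇒≱ half^N<ε (≤-trans ε≤ (κ^≤half^ N))
        in begin
          mass (B x (ε * r))                                             ≈⟨ *-identityˡ _ ⟨
          1# * mass (B x (ε * r))                                        ≈⟨ *-congʳ (half*two^ (suc n)) ⟨
          half ^ suc n * two ^ suc n * mass (B x (ε * r))
            ≈⟨ solve 4 (λ h t p m → h :* (t :* p) :* m := h :* t :* (p :* m)) refl (half ^ suc n) two (two ^ n) _ ⟩
          half ^ suc n * two * (two ^ n * mass (B x (ε * r)))            ≤⟨ *-monoʳ-≤ (*-nonNegative (^-nonNegative (suc n) 0≤half) 0≤two)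
                                                                              (scaling x n 0<r r≤1 0<ε ε≤1 ε≤κⁿ) ⟩
          half ^ suc n * two * (two ^ 3 * mass (B x r))
            ≈⟨ solve 4 (λ h t p m → h :* t :* (p :* m) := t :* p :* h :* m) refl (half ^ suc n) two (two ^ 3) _ ⟩
          two ^ 4 * half ^ suc n * mass (B x r)                          ≤⟨ *-monoˡ-≤ (outer-nonNegative _) (*-monoʳ-≤ (^-nonNegative 4 0≤two)
                                                                              (^ʳ-lower s (suc n) 0<s (<⇒≤ 0<ε) (<⇒≤ (≰⇒> ε≰)))) ⟩
          two ^ 4 * ε ^ʳ fromℕ s ⁻¹ * mass (B x r)                       ∎

  -- The Cantor set

  open Farey
  open Interval using (p; q; p′; q′; size)
  open Move using (a; b; c; d)

  module ℕS = +-*-Solver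

  module _ {x y δ : ℝ} (x+δ≤y : x + δ ≤ y) where

    gap⇒≤∣y-x∣ : δ ≤ ∣ y - x ∣
    gap⇒≤∣y-x∣ = ≤-trans (x+z≤y⇒x≤y-z (≤-respˡ-≈ (+-comm x δ) x+δ≤y)) (x≤∣x∣ _)

    gap⇒≤∣x-y∣ : δ ≤ ∣ x - y ∣
    gap⇒≤∣x-y∣ = ≤-trans gap⇒≤∣y-x∣ (∣x-y∣≤∣y-x∣ y x)

  left : Interval → ℝ
  left I = frac (p I) (q I)

  right : Interval → ℝ
  right I = frac (p′ I) (q′ I)

  numerator-10 : ∀ x y → 1 ℕ.* x ℕ.+ 0 ℕ.* y ≡ x
  numerator-10 x y = ≡.trans (ℕ.+-identityʳ _) (ℕ.+-identityʳ _)

  numerator-01 : ∀ x y → 0 ℕ.* x ℕ.+ 1 ℕ.* y ≡ y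
  numerator-01 x y = ℕ.+-identityʳ _

  width : ∀ {I} → IsFarey I → left I + frac 1 (q I ℕ.* q′ I) ≈ right I
  width F = frac-difference (IsFarey.0<q F) (IsFarey.0<q′ F) (IsFarey.unimodular F)

  module _ {M m I} (F : IsFarey I) (V : IsMove m) (bounded : Bounded M m) where
    open IsFarey F
    open IsMove V hiding (unimodular)
    open Bounded bounded

    -- The parent's left endpoint has weights (1, 0), so by `cross` the exact distance is `b m` over
    -- the product of the denominators, which are at most `size I` and `M * size I`. On the right
    -- the weights are (0, 1) and the determinant is `c m`.
    left-margin : left I + frac 1 (M ℕ.* (size I ℕ.* size I)) ≤ left (step m I)
    left-margin = ≤-trans
      (+-monoʳ-≤ _ (frac-mono-≤ (ℕ.*-mono-≤ (ℕ.≤-trans 0<a a≤) (ℕ.*-mono-≤ (0<size F) (0<size F))) (ℕ.*-mono-≤ 0<q 0<den) bound))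
      (≤-reflexive (frac-difference 0<q 0<den
        (≡.subst₂ (λ s t → numerator I (a m) (b m) ℕ.* t ≡ s ℕ.* denominator I (a m) (b m) ℕ.+ b m)
          (numerator-10 (p I) (p′ I)) (numerator-10 (q I) (q′ I))
          (cross F (a m) (b m) 1 0 (≡.trans (ℕ.*-identityʳ (b m)) (≡.cong (ℕ._+ b m) (≡.sym (ℕ.*-zeroʳ (a m)))))))))
      where
      0<den = 0<denominator F 0<a 0<b
      bound : 1 ℕ.* (q I ℕ.* denominator I (a m) (b m)) ℕ.≤ b m ℕ.* (M ℕ.* (size I ℕ.* size I))
      bound = ℕ.*-mono-≤ 0<b (ℕ.≤-trans (ℕ.*-mono-≤ (ℕ.m≤m+n (q I) (q′ I)) (denominator≤size I a≤ b≤))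
        (ℕ.≤-reflexive (ℕS.solve 2 (λ s m → s ℕS.:* (m ℕS.:* s) ℕS.:= m ℕS.:* (s ℕS.:* s)) ≡.refl (size I) M)))

    right-margin : right (step m I) + frac 1 (M ℕ.* (size I ℕ.* size I)) ≤ right I
    right-margin = ≤-trans
      (+-monoʳ-≤ _ (frac-mono-≤ (ℕ.*-mono-≤ (ℕ.≤-trans 0<a a≤) (ℕ.*-mono-≤ (0<size F) (0<size F))) (ℕ.*-mono-≤ 0<den 0<q′) bound))
      (≤-reflexive (frac-difference 0<den 0<q′
        (≡.subst₂ (λ s t → s ℕ.* denominator I (c m) (d m) ≡ numerator I (c m) (d m) ℕ.* t ℕ.+ c m)
          (numerator-01 (p I) (p′ I)) (numerator-01 (q I) (q′ I))
          (cross F 0 1 (c m) (d m) (ℕ.*-identityˡ (c m))))))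
      where
      0<den = 0<denominator F 0<c 0<d
      bound : 1 ℕ.* (denominator I (c m) (d m) ℕ.* q′ I) ℕ.≤ c m ℕ.* (M ℕ.* (size I ℕ.* size I))
      bound = ℕ.*-mono-≤ 0<c (ℕ.≤-trans (ℕ.*-mono-≤ (denominator≤size I c≤ d≤) (ℕ.m≤n+m (q′ I) (q I)))
        (ℕ.≤-reflexive (ℕ.*-assoc M (size I) (size I))))

    0<margin : 0# < frac 1 (M ℕ.* (size I ℕ.* size I))
    0<margin = frac-positive (s≤s z≤n) (ℕ.*-mono-≤ (ℕ.≤-trans 0<a a≤) (ℕ.*-mono-≤ (0<size F) (0<size F)))

    left-increases : left I ≤ left (step m I)
    left-increases = ≤-trans (x≤x+y (<⇒≤ 0<margin)) left-margin

    right-decreases : right (step m I) ≤ right I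
    right-decreases = ≤-trans (x≤x+y (<⇒≤ 0<margin)) right-margin

  -- The relation `m ≺ n` says that the determinant of the two facing endpoints is positive, hence
  -- at least 1, and both denominators are at most `M * size I`.
  children-gap : ∀ {M m n I} → IsFarey I → IsMove m → IsMove n → Bounded M m → Bounded M n → m ≺ n →
                 right (step m I) + frac 1 ((M ℕ.* size I) ℕ.* (M ℕ.* size I)) ≤ left (step n I)
  children-gap {M} {m} {n} {I} F Vm Vn bm bn m≺n = ≤-trans
    (+-monoʳ-≤ _ (frac-mono-≤ (ℕ.*-mono-≤ 0<MS 0<MS) (ℕ.*-mono-≤ 0<dm 0<dn)
      (ℕ.*-mono-≤ (ℕ.m<n⇒0<n∸m m≺n) (ℕ.*-mono-≤ (denominator≤size I c≤ d≤) (denominator≤size I (Bounded.a≤ bn) (Bounded.b≤ bn))))))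
    (≤-reflexive (frac-difference 0<dm 0<dn (cross F (a n) (b n) (c m) (d m)
      (≡.trans (≡.sym (ℕ.m+[n∸m]≡n (ℕ.<⇒≤ m≺n))) (≡.cong (ℕ._+ (b n ℕ.* c m ℕ.∸ d m ℕ.* a n)) (ℕ.*-comm (d m) (a n)))))))
    where
    open Bounded bm
    0<dm = 0<denominator F (IsMove.0<c Vm) (IsMove.0<d Vm)
    0<dn = 0<denominator F (IsMove.0<a Vn) (IsMove.0<b Vn)
    0<MS : 0 ℕ.< M ℕ.* size I
    0<MS = ℕ.*-mono-≤ (ℕ.≤-trans (IsMove.0<a Vm) a≤) (0<size F)

  -- Opaque, so that the large constants are never unfolded.
  opaque
    C N : ℕ
    C = 500
    N = 4 ℕ.* C

    N-defn : N ≡ 4 ℕ.* C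
    N-defn = ≡.refl

    433≤C : 433 ℕ.≤ C
    433≤C = ℕ.≤ᵇ⇒≤ _ _ _

    2<N : 2 ℕ.< N
    2<N = ℕ.<ᵇ⇒< _ _ _

  M : ℕ
  M = 3 ℕ.+ N

  opaque
    K : ℕ
    K = suc M ℕ.* suc M

    K-defn : K ≡ suc M ℕ.* suc M
    K-defn = ≡.refl

    4≤K : 4 ℕ.≤ K
    4≤K = ℕ.*-mono-≤ {2} {suc M} {2} {suc M} (s≤s (s≤s z≤n)) (s≤s (s≤s z≤n))

  0<K : 0 ℕ.< K
  0<K = ℕ.≤-trans (s≤s z≤n) 4≤K

  -- The first bit of ω chooses between intervals clinging to the left endpoint of
  -- their parent (false), which yield good approximations, and intervals away from
  -- both endpoints (true), which yield badly approximable points.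
  child : Bool → Bool → Move
  child false false = move (3 ℕ.+ N) 1 (2 ℕ.+ N) 1
  child false true  = move (1 ℕ.+ N) 1 N         1
  child true  false = move 2         1 3         2
  child true  true  = move 2         3 1         2

  child-isMove : ∀ u v → IsMove (child u v)
  child-isMove false false = record
    { unimodular = ℕS.solve 1 (λ n → ℕS.con 1 ℕS.:* (ℕS.con 3 ℕS.:+ n) ℕS.:= (ℕS.con 2 ℕS.:+ n) ℕS.:* ℕS.con 1 ℕS.:+ ℕS.con 1) ≡.refl N
    ; 0<a = s≤s z≤n ; 0<b = s≤s z≤n ; 0<c = s≤s z≤n ; 0<d = s≤s z≤n }
  child-isMove false true  = record
    { unimodular = ℕS.solve 1 (λ n → ℕS.con 1 ℕS.:* (ℕS.con 1 ℕS.:+ n) ℕS.:= n ℕS.:* ℕS.con 1 ℕS.:+ ℕS.con 1) ≡.refl N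
    ; 0<a = s≤s z≤n ; 0<b = s≤s z≤n ; 0<c = ℕ.≤-trans (s≤s z≤n) 2<N ; 0<d = s≤s z≤n }
  child-isMove true  false = record { unimodular = ≡.refl ; 0<a = s≤s z≤n ; 0<b = s≤s z≤n ; 0<c = s≤s z≤n ; 0<d = s≤s z≤n }
  child-isMove true  true  = record { unimodular = ≡.refl ; 0<a = s≤s z≤n ; 0<b = s≤s z≤n ; 0<c = s≤s z≤n ; 0<d = s≤s z≤n }

  child-bounded-true : ∀ v → Bounded 3 (child true v)
  child-bounded-true false = record { a≤ = ℕ.≤ᵇ⇒≤ _ _ _ ; b≤ = ℕ.≤ᵇ⇒≤ _ _ _ ; c≤ = ℕ.≤ᵇ⇒≤ _ _ _ ; d≤ = ℕ.≤ᵇ⇒≤ _ _ _ }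
  child-bounded-true true  = record { a≤ = ℕ.≤ᵇ⇒≤ _ _ _ ; b≤ = ℕ.≤ᵇ⇒≤ _ _ _ ; c≤ = ℕ.≤ᵇ⇒≤ _ _ _ ; d≤ = ℕ.≤ᵇ⇒≤ _ _ _ }

  child-bounded : ∀ u v → Bounded M (child u v)
  child-bounded false false = record { a≤ = ℕ.≤-refl ; b≤ = s≤s z≤n ; c≤ = ℕ.n≤1+n _ ; d≤ = s≤s z≤n }
  child-bounded false true  = record { a≤ = ℕ.m≤n+m _ 2 ; b≤ = s≤s z≤n ; c≤ = ℕ.m≤n+m _ 3 ; d≤ = s≤s z≤n }
  child-bounded true  v     = record { a≤ = widen a≤ ; b≤ = widen b≤ ; c≤ = widen c≤ ; d≤ = widen d≤ }
    where
    open Bounded (child-bounded-true v)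
    widen : ∀ {x} → x ℕ.≤ 3 → x ℕ.≤ M
    widen x≤3 = ℕ.≤-trans x≤3 (ℕ.m≤m+n 3 N)

  -- Two different rules meet only at level 0, where `child false false` faces `child true true`.
  -- Treating all pairs of rules lets `next` handle that level like the others.
  children-apart : ∀ u v → child u false ≺ child v true ⊎ child v true ≺ child u false
  children-apart false false = inj₁ (ℕ.≤-reflexive (ℕS.solve 1 (λ n → ℕS.con 1 ℕS.:+ ℕS.con 1 ℕS.:* (ℕS.con 1 ℕS.:+ n) ℕS.:= ℕS.con 1 ℕS.:* (ℕS.con 2 ℕS.:+ n)) ≡.refl N))
  children-apart false true  = inj₁ (ℕ.*-mono-≤ {3} {3} {1} {2 ℕ.+ N} ℕ.≤-refl (s≤s z≤n))
  children-apart true  false = inj₂ (ℕ.≤-trans 2<N (ℕ.m≤m+n N 0))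
  children-apart true  true  = inj₁ (ℕ.<ᵇ⇒< _ _ _)

  -- The first bit is also the first choice. The unit interval thus has two children only,
  -- `child false false` and `child true true`, and the rule itself can be read from the position of
  -- the point.
  level : Ω → ℕ → Interval
  level ω zero    = interval 0 1 1 1
  level ω (suc n) = step (child (ω 0) (ω n)) (level ω n)

  level-farey : ∀ ω n → IsFarey (level ω n)
  level-farey ω zero    = record { unimodular = ≡.refl ; 0<q = s≤s z≤n ; 0<q′ = s≤s z≤n }
  level-farey ω (suc n) = step-farey (child-isMove (ω 0) (ω n)) (level-farey ω n)

  level-balanced : ∀ ω n → Balanced M (level ω n)
  level-balanced ω zero    = s≤s z≤n , s≤s z≤n
  level-balanced ω (suc n) = step-balanced (level ω n) (child-isMove (ω 0) (ω n)) (child-bounded (ω 0) (ω n))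

  level-agree : ∀ n {ω ω′} → Agree n ω ω′ → level ω n ≡ level ω′ n
  level-agree zero    agree = ≡.refl
  level-agree (suc n) agree = ≡.cong₂ step (≡.cong₂ child (agree 0 (s≤s z≤n)) (agree n (ℕ.n<1+n n)))
                                           (level-agree n λ i i<n → agree i (ℕ.m<n⇒m<1+n i<n))

  D : Ω → ℕ → ℕ
  D ω n = size (level ω n)

  n<D : ∀ ω n → n ℕ.< D ω n
  n<D ω zero    = s≤s z≤n
  n<D ω (suc n) = ℕ.≤-trans (ℕ.+-mono-≤ (ℕ.≤-trans (s≤s z≤n) (n<D ω n)) (ℕ.≤-trans (n<D ω n) (ℕ.≤-reflexive (≡.sym (ℕ.+-identityʳ _)))))
    (size-growth (level ω n) (child-isMove (ω 0) (ω n)))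

  0<D : ∀ ω n → 0 ℕ.< D ω n
  0<D ω n = ℕ.≤-trans (s≤s z≤n) (n<D ω n)

  0<D² : ∀ ω n → 0 ℕ.< D ω n ℕ.* D ω n
  0<D² ω n = ℕ.*-mono-≤ (0<D ω n) (0<D ω n)

  D-mono : ∀ ω n → D ω n ℕ.≤ D ω (suc n)
  D-mono ω n = ℕ.≤-trans (ℕ.m≤m+n (D ω n) _) (size-growth (level ω n) (child-isMove (ω 0) (ω n)))

  D-bound : ∀ ω n → D ω (suc n) ℕ.≤ 2 ℕ.* M ℕ.* D ω n
  D-bound ω n = size-bound (level ω n) (child-bounded (ω 0) (ω n))

  L-mono : ∀ ω {m n} → m ℕ.≤ n → left (level ω m) ≤ left (level ω n)
  L-mono ω {m} m≤n = go (ℕ.≤⇒≤′ m≤n)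
    where
    go : ∀ {n} → m ℕ.≤′ n → left (level ω m) ≤ left (level ω n)
    go (ℕ.≤′-reflexive ≡.refl) = ≤-refl
    go {suc n} (ℕ.≤′-step le)  = ≤-trans (go le) (left-increases (level-farey ω n) (child-isMove (ω 0) (ω n)) (child-bounded (ω 0) (ω n)))

  R-antimono : ∀ ω {m n} → m ℕ.≤ n → right (level ω n) ≤ right (level ω m)
  R-antimono ω {m} m≤n = go (ℕ.≤⇒≤′ m≤n)
    where
    go : ∀ {n} → m ℕ.≤′ n → right (level ω n) ≤ right (level ω m)
    go (ℕ.≤′-reflexive ≡.refl) = ≤-refl
    go {suc n} (ℕ.≤′-step le)  = ≤-trans (right-decreases (level-farey ω n) (child-isMove (ω 0) (ω n)) (child-bounded (ω 0) (ω n))) (go le)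

  left≤right : ∀ {I} → IsFarey I → left I ≤ right I
  left≤right F = ≤-respʳ-≈ (width F) (≤-respˡ-≈ (+-identityʳ _) (+-monoʳ-≤ _
    (frac-nonNegative 1 (ℕ.*-mono-≤ (IsFarey.0<q F) (IsFarey.0<q′ F)))))

  L≤R : ∀ ω m n → left (level ω n) ≤ right (level ω m)
  L≤R ω m n = ≤-trans (L-mono ω (ℕ.m≤m⊔n n m)) (≤-trans (left≤right (level-farey ω (n ℕ.⊔ m))) (R-antimono ω (ℕ.m≤n⊔m n m)))

  Φ : Ω → ℝ
  Φ ω = limit (λ n → left (level ω n))

  L≤Φ : ∀ ω n → left (level ω n) ≤ Φ ω
  L≤Φ ω = limit-upperBound _ (L≤R ω 0)

  Φ≤R : ∀ ω n → Φ ω ≤ right (level ω n)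
  Φ≤R ω n = limit-least _ (L≤R ω n)

  -- κ = 2^-s only has to be at most 1 / (4 M² K), and s ≤ 2^s.
  opaque
    s : ℕ
    s = 4 ℕ.* (M ℕ.* M) ℕ.* K

    s-defn : s ≡ 4 ℕ.* (M ℕ.* M) ℕ.* K
    s-defn = ≡.refl

    2≤s : 2 ℕ.≤ s
    2≤s = ℕ.*-mono-≤ {2} {4 ℕ.* (M ℕ.* M)} {1} {K} (ℕ.≤-trans (s≤s (s≤s z≤n)) (ℕ.*-monoʳ-≤ 4 {1} {M ℕ.* M} (s≤s z≤n))) 0<K

  -- By `balanced-size²` this dominates the width 1 / (q q′) of the level, and it depends on the
  -- level through `D` only.
  e : Ω → ℕ → ℝ
  e ω n = frac K (D ω n ℕ.* D ω n)

  0<s′ : 0 ℕ.< s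
  0<s′ = ℕ.≤-trans (s≤s z≤n) 2≤s

  κ-frac : ∀ {x} → 0 ℕ.< x → half ^ s * frac K x ≤ frac K (s ℕ.* x)
  κ-frac {x} 0<x = begin
    half ^ s * frac K x        ≤⟨ *-monoˡ-≤ (frac-nonNegative K 0<x) (≤-frac 0<s′ (≤-respʳ-≈ (sym (+-identityʳ 1#)) (fromℕ*half^≤1 s))) ⟩
    frac 1 s * frac K x        ≈⟨ frac-* 1 K 0<s′ 0<x ⟩
    frac (1 ℕ.* K) (s ℕ.* x)   ≡⟨ ≡.cong (λ k → frac k (s ℕ.* x)) (ℕ.*-identityˡ K) ⟩
    frac K (s ℕ.* x)           ∎

  -- Here the factor M² K of `s` is spent; `e-ratio` spends its factor 4 M².
  κe≤gap : ∀ ω n → half ^ s * e ω n ≤ frac 1 ((M ℕ.* D ω n) ℕ.* (M ℕ.* D ω n))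
  κe≤gap ω n = ≤-trans (κ-frac (0<D² ω n)) (frac-mono-≤ (ℕ.*-mono-≤ 0<s′ (0<D² ω n)) (ℕ.*-mono-≤ 0<MD 0<MD)
    (ℕ.≤-trans (bound M K (D ω n)) (ℕ.≤-reflexive (≡.trans (≡.cong (ℕ._* (D ω n ℕ.* D ω n)) (≡.sym s-defn)) (≡.sym (ℕ.*-identityˡ _))))))
    where
    0<MD = ℕ.*-mono-≤ {1} {M} (s≤s z≤n) (0<D ω n)
    bound : ∀ m k x → k ℕ.* ((m ℕ.* x) ℕ.* (m ℕ.* x)) ℕ.≤ 4 ℕ.* (m ℕ.* m) ℕ.* k ℕ.* (x ℕ.* x)
    bound m k x = ℕ.≤-trans (ℕ.m≤n*m (k ℕ.* ((m ℕ.* x) ℕ.* (m ℕ.* x))) 4) (ℕ.≤-reflexive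
      (ℕS.solve 3 (λ m k x → ℕS.con 4 ℕS.:* (k ℕS.:* ((m ℕS.:* x) ℕS.:* (m ℕS.:* x))) ℕS.:= ℕS.con 4 ℕS.:* (m ℕS.:* m) ℕS.:* k ℕS.:* (x ℕS.:* x)) ≡.refl m k x))

  scheme : CantorScheme
  scheme = record
    { Φ         = Φ
    ; e         = e
    ; s         = s
    ; 2≤s       = 2≤s
    ; e-root    = e-root
    ; e-small   = e-small
    ; e-ratio   = e-ratio
    ; close     = close
    ; separated = separated
    }
    where
    e-root : ∀ ω → 1# ≤ e ω 0
    -- `D ω 0` is 2, so the value is K / 4.
    e-root ω = ≤-frac (s≤s z≤n) (≤-trans (≤-reflexive (trans (*-comm _ _) (*-identityˡ _))) (fromℕ-mono-≤ {4} {K} 4≤K))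

    e-small : ∀ ω {δ} → 0# < δ → ∃[ n ] e ω n ≤ δ
    e-small ω {δ} 0<δ =
      let n , K/δ<n = archimedean (fromℕ K * δ ⁻¹)
      in n , frac-≤ (0<D² ω n) (begin
        fromℕ K                        ≈⟨ trans (*-comm _ _) (*-identityˡ _) ⟨
        fromℕ K * 1#                   ≈⟨ *-congˡ (⁻¹-inverse 0<δ) ⟨
        fromℕ K * (δ * δ ⁻¹)           ≈⟨ solve 3 (λ k d i → k :* (d :* i) := k :* i :* d) refl (fromℕ K) δ (δ ⁻¹) ⟩
        fromℕ K * δ ⁻¹ * δ             ≤⟨ *-monoˡ-≤ (<⇒≤ 0<δ) (<⇒≤ K/δ<n) ⟩
        fromℕ n * δ                    ≤⟨ *-monoˡ-≤ (<⇒≤ 0<δ) (fromℕ-mono-≤ {n} {D ω n ℕ.* D ω n} (ℕ.≤-trans (ℕ.<⇒≤ (n<D ω n))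
                                            (ℕ.≤-trans (ℕ.≤-reflexive (≡.sym (ℕ.*-identityʳ _))) (ℕ.*-monoʳ-≤ (D ω n) (0<D ω n))))) ⟩
        fromℕ (D ω n ℕ.* D ω n) * δ    ∎)

    e-ratio : ∀ ω n → half ^ s * e ω n ≤ e ω (suc n)
    e-ratio ω n = ≤-trans (κ-frac (0<D² ω n)) (frac-mono-≤ (ℕ.*-mono-≤ 0<s′ (0<D² ω n)) (0<D² ω (suc n))
      (ℕ.*-monoʳ-≤ K (ℕ.≤-trans (ℕ.*-mono-≤ (D-bound ω n) (D-bound ω n))
        (ℕ.≤-trans (bound M K (D ω n) 0<K) (ℕ.≤-reflexive (≡.cong (ℕ._* (D ω n ℕ.* D ω n)) (≡.sym s-defn)))))))
      where
      bound : ∀ m k x → 0 ℕ.< k → (2 ℕ.* m ℕ.* x) ℕ.* (2 ℕ.* m ℕ.* x) ℕ.≤ 4 ℕ.* (m ℕ.* m) ℕ.* k ℕ.* (x ℕ.* x)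
      bound m (suc k) x _ = ℕ.≤-trans (ℕ.m≤m+n _ (4 ℕ.* (m ℕ.* m) ℕ.* k ℕ.* (x ℕ.* x))) (ℕ.≤-reflexive
        (ℕS.solve 3 (λ m k x → (ℕS.con 2 ℕS.:* m ℕS.:* x) ℕS.:* (ℕS.con 2 ℕS.:* m ℕS.:* x) ℕS.:+ ℕS.con 4 ℕS.:* (m ℕS.:* m) ℕS.:* k ℕS.:* (x ℕS.:* x)
          ℕS.:= ℕS.con 4 ℕS.:* (m ℕS.:* m) ℕS.:* (ℕS.con 1 ℕS.:+ k) ℕS.:* (x ℕS.:* x)) ≡.refl m k x))

    close : ∀ n {ω ω′} → Agree n ω ω′ → ∣ Φ ω - Φ ω′ ∣ ≤ e ω n
    close n {ω} {ω′} agree = ∣x-y∣≤ (within ω ω′ ≡.refl (level-agree n agree)) (within ω′ ω (level-agree n agree) ≡.refl)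
      where
      F = level-farey ω n
      0<qq′ = ℕ.*-mono-≤ (IsFarey.0<q F) (IsFarey.0<q′ F)
      thin : frac 1 (q (level ω n) ℕ.* q′ (level ω n)) ≤ e ω n
      thin = frac-mono-≤ 0<qq′ (0<D² ω n)
        (ℕ.≤-trans (ℕ.≤-reflexive (ℕ.*-identityˡ _)) (≡.subst (λ k → D ω n ℕ.* D ω n ℕ.≤ k ℕ.* (q (level ω n) ℕ.* q′ (level ω n))) (≡.sym K-defn) (balanced-size² M (level ω n) (level-balanced ω n))))
      within : ∀ ω₁ ω₂ → level ω n ≡ level ω₁ n → level ω n ≡ level ω₂ n → Φ ω₁ ≤ Φ ω₂ + e ω n
      within ω₁ ω₂ eq₁ eq₂ = begin
        Φ ω₁                                                     ≤⟨ Φ≤R ω₁ n ⟩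
        right (level ω₁ n)                                       ≡⟨ ≡.cong right eq₁ ⟨
        right (level ω n)                                        ≈⟨ width F ⟨
        left (level ω n) + frac 1 (q (level ω n) ℕ.* q′ (level ω n)) ≤⟨ +-monoʳ-≤ _ thin ⟩
        left (level ω n) + e ω n                                 ≡⟨ ≡.cong (λ I → left I + e ω n) eq₂ ⟩
        left (level ω₂ n) + e ω n                                ≤⟨ +-monoˡ-≤ _ (L≤Φ ω₂ n) ⟩
        Φ ω₂ + e ω n                                             ∎

    gap : ∀ n {ω ω′} → level ω n ≡ level ω′ n → child (ω 0) (ω n) ≺ child (ω′ 0) (ω′ n) →
          Φ ω + half ^ s * e ω n ≤ Φ ω′
    gap n {ω} {ω′} eq apart = begin
      Φ ω + half ^ s * e ω n                             ≤⟨ +-mono-≤ (Φ≤R ω (suc n)) (κe≤gap ω n) ⟩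
      right (level ω (suc n)) + frac 1 ((M ℕ.* D ω n) ℕ.* (M ℕ.* D ω n))
        ≤⟨ children-gap (level-farey ω n) (child-isMove (ω 0) (ω n)) (child-isMove (ω′ 0) (ω′ n))
                        (child-bounded (ω 0) (ω n)) (child-bounded (ω′ 0) (ω′ n)) apart ⟩
      left (step (child (ω′ 0) (ω′ n)) (level ω n))      ≡⟨ ≡.cong (λ I → left (step (child (ω′ 0) (ω′ n)) I)) eq ⟩
      left (level ω′ (suc n))                            ≤⟨ L≤Φ ω′ (suc n) ⟩
      Φ ω′                                               ∎

    e-agree : ∀ n {ω ω′} → level ω n ≡ level ω′ n → e ω n ≡ e ω′ n
    e-agree n eq = ≡.cong (λ I → frac K (size I ℕ.* size I)) eq

    far : ∀ n {ω ω′} → level ω n ≡ level ω′ n →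
          child (ω 0) (ω n) ≺ child (ω′ 0) (ω′ n) ⊎ child (ω′ 0) (ω′ n) ≺ child (ω 0) (ω n) →
          half ^ s * e ω n ≤ ∣ Φ ω - Φ ω′ ∣
    far n {ω} {ω′} eq (inj₁ apart) = gap⇒≤∣x-y∣ (gap n eq apart)
    far n {ω} {ω′} eq (inj₂ apart) = gap⇒≤∣y-x∣ (≡.subst (λ z → Φ ω′ + half ^ s * z ≤ Φ ω) (≡.sym (e-agree n eq)) (gap n (≡.sym eq) apart))

    apart : ∀ u u′ v v′ → v ≢ v′ → child u v ≺ child u′ v′ ⊎ child u′ v′ ≺ child u v
    apart u u′ false false v≢v′ = contradiction ≡.refl v≢v′
    apart u u′ false true  v≢v′ = children-apart u u′
    apart u u′ true  false v≢v′ with children-apart u′ u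
    ... | inj₁ lt = inj₂ lt
    ... | inj₂ lt = inj₁ lt
    apart u u′ true  true  v≢v′ = contradiction ≡.refl v≢v′

    next : ∀ n {ω ω′} → Agree n ω ω′ → ∣ Φ ω - Φ ω′ ∣ < half ^ s * e ω n → Agree (suc n) ω ω′
    next n {ω} {ω′} agree near i i<1+n with ℕ.m<1+n⇒m<n∨m≡n i<1+n | ω n Bool.≟ ω′ n
    ... | inj₁ i<n    | _       = agree i i<n
    ... | inj₂ ≡.refl | yes eq  = eq
    ... | inj₂ ≡.refl | no neq  = contradiction (far n (level-agree n agree) (apart (ω 0) (ω′ 0) (ω n) (ω′ n) neq)) (<⇒≱ near)

    e-decreases : ∀ ω n → e ω (suc n) ≤ e ω n
    e-decreases ω n = frac-mono-≤ (0<D² ω (suc n)) (0<D² ω n) (ℕ.*-monoʳ-≤ K (ℕ.*-mono-≤ (D-mono ω n) (D-mono ω n)))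

    -- Bits are recovered one at a time: as `e` decreases, closeness at scale `n` is closeness at
    -- all earlier scales, and a first differing bit would put the points into children that are
    -- apart.
    separated : ∀ n {ω ω′} → ∣ Φ ω - Φ ω′ ∣ < half ^ s * e ω n → Agree (suc n) ω ω′
    separated zero    near = next zero (λ _ ()) near
    separated (suc n) {ω} near = next (suc n)
      (separated n (<-≤-trans near (*-monoʳ-≤ (<⇒≤ (^-positive s 0<half)) (e-decreases ω n)))) near

  -- Diophantine approximation

  0<↧ₙ : ∀ r → 0 ℕ.< ↧ₙ r
  0<↧ₙ (mkℚ _ _ _) = s≤s z≤n

  rational-outside : ∀ {I} → IsFarey I → ∀ r → ↧ₙ r ℕ.< size I → fromℚ r ≤ left I ⊎ right I ≤ fromℚ r
  rational-outside {I} F r small with ↥ r in eq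
  ... | + n = outside-frac (outside F {n} small)
    where
    outside-frac : n ℕ.* q I ℕ.≤ p I ℕ.* ↧ₙ r ⊎ p′ I ℕ.* ↧ₙ r ℕ.≤ n ℕ.* q′ I →
                   fromℤ (+ n) * fromℕ (↧ₙ r) ⁻¹ ≤ left I ⊎ right I ≤ fromℤ (+ n) * fromℕ (↧ₙ r) ⁻¹
    outside-frac rewrite ≡.sym (frac-defn n (↧ₙ r)) = λ
      { (inj₁ le) → inj₁ (frac-mono-≤ (0<↧ₙ r) (IsFarey.0<q F) le)
      ; (inj₂ le) → inj₂ (frac-mono-≤ (IsFarey.0<q′ F) (0<↧ₙ r) le)
      }
  -- A negative rational lies below 0, and the left endpoint of an interval with natural entries
  -- does not.
  ... | -[1+ n ] = inj₁ (begin
    - fromℕ (suc n) * fromℕ (↧ₙ r) ⁻¹   ≤⟨ *-monoˡ-≤ (<⇒≤ (⁻¹-positive (fromℕ-positive (0<↧ₙ r)))) (neg-mono-≤ (fromℕ-nonNegative (suc n))) ⟩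
    - 0# * fromℕ (↧ₙ r) ⁻¹              ≈⟨ solve 1 (λ x → (:- con (+ 0)) :* x := con (+ 0)) refl _ ⟩
    0#                                  ≤⟨ frac-nonNegative (p I) (IsFarey.0<q F) ⟩
    left I                              ∎)

  -- A rational of denominator below `D ω k` is not inside the interval of level `k`, while Φ ω lies
  -- in a child, away from both ends by the margin. The bound `M₀` is left free: it is 3 under the
  -- second rule and `M` in general.
  rational-distance : ∀ {M₀} ω k → Bounded M₀ (child (ω 0) (ω k)) → ∀ r → ↧ₙ r ℕ.< D ω k →
                      frac 1 (M₀ ℕ.* (D ω k ℕ.* D ω k)) ≤ ∣ Φ ω - fromℚ r ∣
  rational-distance ω k bounded r small with rational-outside (level-farey ω k) r small
  ... | inj₁ r≤L = gap⇒≤∣y-x∣ (≤-trans (+-monoˡ-≤ _ r≤L)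
    (≤-trans (left-margin (level-farey ω k) (child-isMove (ω 0) (ω k)) bounded) (L≤Φ ω (suc k))))
  ... | inj₂ R≤r = gap⇒≤∣x-y∣ (≤-trans (+-monoˡ-≤ _ (Φ≤R ω (suc k)))
    (≤-trans (right-margin (level-farey ω k) (child-isMove (ω 0) (ω k)) bounded) R≤r))

  Φ-irrational : ∀ ω → Irrational (Φ ω)
  Φ-irrational ω r Φ≈r = <⇒≱ (0<margin (level-farey ω k) (child-isMove (ω 0) (ω k)) (child-bounded (ω 0) (ω k)))
    (≤-trans (rational-distance ω k (child-bounded (ω 0) (ω k)) r (n<D ω k))
      (∣x-y∣≤ (≤-reflexive (trans Φ≈r (sym (+-identityʳ _)))) (≤-reflexive (trans (sym Φ≈r) (sym (+-identityʳ _))))))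
    -- Sizes exceed level numbers, so at this level the denominator of `r` is too small for `r` to
    -- lie inside.
    where k = ↧ₙ r

  -- The shift to `suc n` keeps the denominator positive at index 0, so that ψ is positive and
  -- decreasing on all of ℕ.
  ψ : ℕ → ℝ
  ψ n = frac 1 (C ℕ.* (suc n ℕ.* suc n))

  0<C : 0 ℕ.< C
  0<C = ℕ.≤-trans (s≤s z≤n) 433≤C

  0<denominatorψ : ∀ n → 0 ℕ.< C ℕ.* (suc n ℕ.* suc n)
  0<denominatorψ n = ℕ.*-mono-≤ 0<C (s≤s (z≤n {n ℕ.+ n ℕ.* suc n}))

  ψ-positive : Positive ψ
  ψ-positive n = frac-positive (s≤s z≤n) (0<denominatorψ n)

  ψ-decreasing : Decreasing ψ
  ψ-decreasing {m} {n} m≤n = frac-mono-≤ (0<denominatorψ n) (0<denominatorψ m)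
    (ℕ.*-monoʳ-≤ 1 (ℕ.*-monoʳ-≤ C (ℕ.*-mono-≤ (s≤s m≤n) (s≤s m≤n))))

  -- Even one approximation is impossible. For a denominator n take the level where `D` first
  -- exceeds 2n; there n < D ≤ 12 n, and the distance is at least 1 / (3 D²), hence at least 1 /
  -- (432 n²), which is more than ψ(n).
  badly-approximable : ∀ ω → ω 0 ≡ true → ¬ Approximable ψ (Φ ω)
  badly-approximable ω ω0≡true (_ , f , _ , near) = ℕ.<⇒≱ too-close
    (≡.subst₂ ℕ._≤_ (ℕ.*-identityˡ _) (ℕ.*-identityˡ _)
      (frac-cancel-≤ {1} {_} {1} (ℕ.*-mono-≤ {1} {3} (s≤s z≤n) (0<D² ω (suc j))) (0<denominatorψ n)
        (≤-trans (rational-distance ω (suc j) (bounded (suc j)) r n<D′) (near 0))))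
    where
    r = f 0
    n = ↧ₙ r
    bounded : ∀ k → Bounded 3 (child (ω 0) (ω k))
    bounded k = ≡.subst (λ u → Bounded 3 (child u (ω k))) (≡.sym ω0≡true) (child-bounded-true (ω k))
    -- The threshold is 2n rather than n because `D ω 0` is 2 and level 0 must lie below it even
    -- when n = 1.
    critical : ∃[ j ] D ω j ℕ.≤ 2 ℕ.* n × ¬ (D ω (suc j) ℕ.≤ 2 ℕ.* n)
    critical = crossing (λ j → D ω j ℕ.≤ 2 ℕ.* n) (ℕ.*-monoʳ-≤ 2 (0<↧ₙ r)) (2 ℕ.* n) (ℕ.<⇒≱ (n<D ω (2 ℕ.* n)))
    j = proj₁ critical
    n<D′ : n ℕ.< D ω (suc j)
    n<D′ = ℕ.≤-<-trans (ℕ.m≤m+n n _) (ℕ.≰⇒> (proj₂ (proj₂ critical)))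
    D≤ : D ω (suc j) ℕ.≤ 12 ℕ.* n
    D≤ = ℕ.≤-trans (size-bound (level ω j) (bounded j)) (ℕ.≤-trans (ℕ.*-monoʳ-≤ 6 (proj₁ (proj₂ critical)))
      (ℕ.≤-reflexive (≡.sym (ℕ.*-assoc 6 2 n))))
    too-close : 3 ℕ.* (D ω (suc j) ℕ.* D ω (suc j)) ℕ.< C ℕ.* (suc n ℕ.* suc n)
    -- The constant 433 is 3 · 12² + 1.
    too-close = ℕ.≤-<-trans (ℕ.*-monoʳ-≤ 3 (ℕ.*-mono-≤ D≤ D≤)) (ℕ.<-≤-trans
      (≡.subst (ℕ._< 433 ℕ.* (suc n ℕ.* suc n))
        (ℕS.solve 1 (λ n → ℕS.con 432 ℕS.:* (n ℕS.:* n) ℕS.:= ℕS.con 3 ℕS.:* ((ℕS.con 12 ℕS.:* n) ℕS.:* (ℕS.con 12 ℕS.:* n))) ≡.refl n)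
        (ℕ.≤-<-trans (ℕ.*-monoˡ-≤ (n ℕ.* n) (ℕ.n≤1+n 432)) (ℕ.*-monoʳ-< 433 (ℕ.*-mono-< (ℕ.n<1+n n) (ℕ.n<1+n n)))))
      (ℕ.*-monoˡ-≤ (suc n ℕ.* suc n) 433≤C))

  -- Endpoints of Farey intervals are already in lowest terms, so the rational keeps `q` itself as
  -- denominator, and ψ is evaluated there.
  fraction : ∀ p q → 0 ℕ.< q → Coprime p q → ℚ
  fraction p (suc q) _ coprime = mkℚ (+ p) q coprime

  fromℚ-fraction : ∀ p q 0<q (coprime : Coprime p q) → fromℚ (fraction p q 0<q coprime) ≡ frac p q
  fromℚ-fraction p (suc q) 0<q coprime = ≡.sym (frac-defn p (suc q))

  ↧ₙ-fraction : ∀ p q 0<q (coprime : Coprime p q) → ↧ₙ (fraction p q 0<q coprime) ≡ q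
  ↧ₙ-fraction p (suc q) 0<q coprime = ≡.refl

  level-coprime : ∀ ω n → Coprime (p (level ω n)) (q (level ω n))
  level-coprime ω n = farey-coprime (level-farey ω n)

  endpoint : Ω → ℕ → ℚ
  endpoint ω n = fraction (p (level ω n)) (q (level ω n)) (IsFarey.0<q (level-farey ω n)) (level-coprime ω n)

  ↧ₙ-endpoint : ∀ ω n → ↧ₙ (endpoint ω n) ≡ q (level ω n)
  ↧ₙ-endpoint ω n = ↧ₙ-fraction (p (level ω n)) (q (level ω n)) _ (level-coprime ω n)

  q-mono-< : ∀ ω {m n} → m ℕ.< n → q (level ω m) ℕ.< q (level ω n)
  q-mono-< ω {m} m<n = go (ℕ.≤⇒≤′ m<n)
    where
    increases : ∀ n → q (level ω n) ℕ.< q (level ω (suc n))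
    increases n = q-increases (child-isMove (ω 0) (ω n)) (level-farey ω n)
    go : ∀ {n} → suc m ℕ.≤′ n → q (level ω m) ℕ.< q (level ω n)
    go (ℕ.≤′-reflexive ≡.refl) = increases m
    go {suc n} (ℕ.≤′-step le)  = ℕ.<-trans (go le) (increases n)

  endpoint-injective : ∀ ω → Injective _≡_ _≡_ (endpoint ω)
  endpoint-injective ω {m} {n} eq with ℕ.<-cmp m n
  ... | tri< m<n _ _ = contradiction (≡.trans (≡.sym (↧ₙ-endpoint ω m)) (≡.trans (≡.cong ↧ₙ_ eq) (↧ₙ-endpoint ω n))) (ℕ.<⇒≢ (q-mono-< ω m<n))
  ... | tri≈ _ m≡n _ = m≡n
  ... | tri> _ _ n<m = contradiction (≡.trans (≡.sym (↧ₙ-endpoint ω n)) (≡.trans (≡.cong ↧ₙ_ (≡.sym eq)) (↧ₙ-endpoint ω m))) (ℕ.<⇒≢ (q-mono-< ω n<m))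

  child-false : ∀ v → N ℕ.≤ c (child false v) × d (child false v) ≡ 1
  child-false false = ℕ.m≤n+m N 2 , ≡.refl
  child-false true  = ℕ.≤-refl , ≡.refl

  -- The right end of the child exceeds the left end of the parent by exactly `d m` over the product
  -- of denominators. Under the first rule `d m` is 1 and the child's denominator is at least `N` q,
  -- so the excess is at most 1 / (4 C q²).
  near-endpoint : ∀ ω n → ω 0 ≡ false → Φ ω ≤ left (level ω n) + ψ (q (level ω n))
  near-endpoint ω n ω0≡false = begin
    Φ ω                                                 ≤⟨ Φ≤R ω (suc n) ⟩
    right (step m I)                                    ≈⟨ frac-difference 0<q 0<den difference ⟨
    left I + frac (d m) (q I ℕ.* denominator I (c m) (d m)) ≤⟨ +-monoʳ-≤ _ (frac-mono-≤ (ℕ.*-mono-≤ 0<q 0<den) (0<denominatorψ (q I)) bound) ⟩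
    left I + ψ (q I)                                    ∎
    where
    I = level ω n
    m = child (ω 0) (ω n)
    F = level-farey ω n
    open IsFarey F
    0<den = 0<denominator F (IsMove.0<c (child-isMove (ω 0) (ω n))) (IsMove.0<d (child-isMove (ω 0) (ω n)))
    difference : numerator I (c m) (d m) ℕ.* q I ≡ p I ℕ.* denominator I (c m) (d m) ℕ.+ d m
    difference = ≡.subst₂ (λ s t → numerator I (c m) (d m) ℕ.* t ≡ s ℕ.* denominator I (c m) (d m) ℕ.+ d m)
      (numerator-10 (p I) (p′ I)) (numerator-10 (q I) (q′ I))
      (cross F (c m) (d m) 1 0 (≡.trans (ℕ.*-identityʳ (d m)) (≡.cong (ℕ._+ d m) (≡.sym (ℕ.*-zeroʳ (c m))))))
    clinging : N ℕ.≤ c m × d m ≡ 1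
    clinging = ≡.subst (λ u → N ℕ.≤ c (child u (ω n)) × d (child u (ω n)) ≡ 1) (≡.sym ω0≡false) (child-false (ω n))
    -- The 4 in `N = 4 C` pays for q + 1 ≤ 2 q.
    square : ∀ k x → 0 ℕ.< x → k ℕ.* (suc x ℕ.* suc x) ℕ.≤ x ℕ.* (4 ℕ.* k ℕ.* x)
    square k x 0<x = ℕ.≤-trans (ℕ.*-monoʳ-≤ k (ℕ.*-mono-≤ (ℕ.+-monoˡ-≤ x 0<x) (ℕ.+-monoˡ-≤ x 0<x)))
      (ℕ.≤-reflexive (ℕS.solve 2 (λ k x → k ℕS.:* ((x ℕS.:+ x) ℕS.:* (x ℕS.:+ x)) ℕS.:= x ℕS.:* (ℕS.con 4 ℕS.:* k ℕS.:* x)) ≡.refl k x))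
    bound : d m ℕ.* (C ℕ.* (suc (q I) ℕ.* suc (q I))) ℕ.≤ 1 ℕ.* (q I ℕ.* denominator I (c m) (d m))
    bound = ℕ.*-mono-≤ (ℕ.≤-reflexive (proj₂ clinging)) (ℕ.≤-trans (square C (q I) 0<q)
      (ℕ.*-monoʳ-≤ (q I) (ℕ.≤-trans (ℕ.*-monoˡ-≤ (q I) (ℕ.≤-trans (ℕ.≤-reflexive (≡.sym N-defn)) (proj₁ clinging))) (ℕ.m≤m+n _ _))))

  well-approximable : ∀ ω → ω 0 ≡ false → Approximable ψ (Φ ω)
  well-approximable ω ω0≡false = Φ-irrational ω , endpoint ω , endpoint-injective ω , λ n →
    ≡.subst₂ (λ x k → ∣ Φ ω - x ∣ ≤ ψ k) (≡.sym (fromℚ-fraction (p (level ω n)) (q (level ω n)) _ (level-coprime ω n))) (≡.sym (↧ₙ-endpoint ω n))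
      (∣x-y∣≤ (near-endpoint ω n ω0≡false)
              (≤-trans (L≤Φ ω n) (x≤x+y (<⇒≤ (ψ-positive (q (level ω n)))))))

  -- Divergence of the Khinchin series.

  term : ℕ → ℝ
  term n = fromℕ n * ψ n

  term-nonNegative : ∀ n → 0# ≤ term n
  term-nonNegative n = *-nonNegative (fromℕ-nonNegative n) (<⇒≤ (ψ-positive n))

  fromℕ*frac : ∀ k a {b} → 0 ℕ.< b → fromℕ k * frac a b ≈ frac (k ℕ.* a) b
  fromℕ*frac k a {b} 0<b = frac-unique 0<b (trans
    (solve 3 (λ k b x → b :* (k :* x) := k :* (b :* x)) refl (fromℕ k) (fromℕ b) _)
    (trans (*-congˡ (*-frac a 0<b)) (sym (fromℕ-* k a))))

  0<N : 0 ℕ.< N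
  0<N = ℕ.≤-trans (s≤s z≤n) 2<N

  -- Oresme's estimate for the harmonic series: for k ≤ n < 2k the term is at least k / (C (2k)²),
  -- which is 1 / (4 C k).
  term-≥ : ∀ {k n} → 0 ℕ.< k → k ℕ.≤ n → suc n ℕ.≤ k ℕ.+ k → frac 1 (N ℕ.* k) ≤ term n
  term-≥ {k} {n} 0<k k≤n n<2k = ≤-respʳ-≈ (sym (fromℕ*frac n 1 (0<denominatorψ n)))
    (frac-mono-≤ (ℕ.*-mono-≤ 0<N 0<k) (0<denominatorψ n) (ℕ.≤-trans (ℕ.≤-reflexive (ℕ.*-identityˡ _))
      (ℕ.≤-trans (ℕ.*-monoʳ-≤ C (ℕ.*-mono-≤ n<2k n<2k)) (ℕ.≤-trans
        (ℕ.≤-reflexive (ℕS.solve 2 (λ c k → c ℕS.:* ((k ℕS.:+ k) ℕS.:* (k ℕS.:+ k)) ℕS.:= k ℕS.:* (ℕS.con 4 ℕS.:* c ℕS.:* k)) ≡.refl C k))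
        (ℕ.*-mono-≤ (ℕ.≤-trans k≤n (ℕ.≤-reflexive (≡.sym (ℕ.*-identityʳ n)))) (ℕ.*-monoˡ-≤ k (ℕ.≤-reflexive (≡.sym N-defn))))))))

  block : ∀ {k} → 0 ℕ.< k → ∀ m → m ℕ.≤ k → sum term k + fromℕ m * frac 1 (N ℕ.* k) ≤ sum term (m ℕ.+ k)
  block {k} 0<k zero    _   = ≤-reflexive (trans (+-congˡ (zeroˡ _)) (+-identityʳ _))
  block {k} 0<k (suc m) m<k = begin
    sum term k + (1# + fromℕ m) * frac 1 (N ℕ.* k)
      ≈⟨ solve 3 (λ s m x → s :+ (con (+ 1) :+ m) :* x := s :+ m :* x :+ x) refl (sum term k) (fromℕ m) _ ⟩
    sum term k + fromℕ m * frac 1 (N ℕ.* k) + frac 1 (N ℕ.* k)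
      ≤⟨ +-mono-≤ (block 0<k m (ℕ.<⇒≤ m<k)) (term-≥ 0<k (ℕ.m≤n+m k m) (ℕ.+-monoˡ-≤ k m<k)) ⟩
    sum term (m ℕ.+ k) + term (m ℕ.+ k) ∎

  -- The `k` terms from index `k` on are each at least 1 / (N k), so every doubling adds a fixed
  -- amount.
  doubling : ∀ {k} → 0 ℕ.< k → sum term k + frac 1 N ≤ sum term (k ℕ.+ k)
  doubling {k} 0<k = ≤-trans (+-monoʳ-≤ _ (≤-respʳ-≈ (sym (fromℕ*frac k 1 0<Nk))
    (frac-mono-≤ 0<N 0<Nk (ℕ.≤-reflexive (ℕS.solve 2 (λ k n → ℕS.con 1 ℕS.:* (n ℕS.:* k) ℕS.:= k ℕS.:* ℕS.con 1 ℕS.:* n) ≡.refl k N)))))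
    (block 0<k k ℕ.≤-refl)
    where
    0<Nk = ℕ.*-mono-≤ 0<N 0<k

  sum-unbounded : ∀ i → ∃[ k ] 0 ℕ.< k × fromℕ i * frac 1 N ≤ sum term k
  sum-unbounded zero    = 1 , s≤s z≤n , ≤-trans (≤-reflexive (zeroˡ _)) (sum-nonNegative term-nonNegative 1)
  sum-unbounded (suc i) =
    let k , 0<k , le = sum-unbounded i
    in k ℕ.+ k , ℕ.≤-trans 0<k (ℕ.m≤m+n k k) , (begin
      (1# + fromℕ i) * frac 1 N     ≈⟨ solve 2 (λ i x → (con (+ 1) :+ i) :* x := i :* x :+ x) refl (fromℕ i) _ ⟩
      fromℕ i * frac 1 N + frac 1 N ≤⟨ +-monoˡ-≤ _ le ⟩
      sum term k + frac 1 N         ≤⟨ doubling 0<k ⟩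
      sum term (k ℕ.+ k)            ∎)

  open Decay scheme public

  series-diverges : KhinchinSeriesDiverges ψ
  series-diverges = (λ _ → _ ≤⊤⁺) , λ
    { ⊤⁺    _  → _ ≤⊤⁺
    ; [ y ] ≤y → ⊥-elim (unbounded y λ n → [≤]-injective _≤_ (≤y (n , ≡.sym (partialSum-finite term n))))
    }
    where
    unbounded : ∀ y → ¬ (∀ n → sum term n ≤ y)
    unbounded y sum≤y =
      let i , yN<i = archimedean (fromℕ N * y)
          k , _ , le = sum-unbounded i
      in <⇒≱ yN<i (begin
        fromℕ i                          ≈⟨ trans (*-comm _ _) (*-identityˡ _) ⟨
        fromℕ i * 1#                     ≈⟨ *-congˡ (+-identityʳ 1#) ⟨
        fromℕ i * fromℕ 1                ≈⟨ *-congˡ (*-frac 1 0<N) ⟨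
        fromℕ i * (fromℕ N * frac 1 N)   ≈⟨ solve 3 (λ i n x → i :* (n :* x) := n :* (i :* x)) refl (fromℕ i) (fromℕ N) _ ⟩
        fromℕ N * (fromℕ i * frac 1 N)   ≤⟨ *-monoʳ-≤ (fromℕ-nonNegative N) (≤-trans le (sum≤y k)) ⟩
        fromℕ N * y                      ∎)

  -- Both kinds of points carry mass.

  -- The preimage of any set containing `A` includes all sequences with first bit `v`, and these
  -- have positive outer measure.
  not-null : ∀ v {A : Pred ℝ 0ℓ} → (∀ ω → ω 0 ≡ v → A (Φ ω)) → ¬ IsNull pushforward A
  not-null v A-Φ (B₀ , _ , A⊆B₀ , [ B₀≈0 ]≈) =
    <⇒≱ (outer-head-positive v) (≤-trans (outer-mono λ {ω} eq → A⊆B₀ (A-Φ ω eq)) (≤-reflexive B₀≈0))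

  nonzero : NonzeroMeasure pushforward
  nonzero [ U≈0 ]≈ = <⇒≱ 0<1 (≤-trans (outer-U λ _ → _) (≤-reflexive U≈0))

  not-approximable-not-null : ¬ IsNull pushforward (∁ (Approximable ψ))
  not-approximable-not-null = not-null true badly-approximable

corollary1p7 : (∀ {ℓ} → ExcludedMiddle ℓ) → (R : CompleteOrderedField) →
  let open CompleteOrderedField R using () renaming (Carrier to ℝ)
      open RealAnalysis R
  in
  (Σ[ m ∈ Measure ] Σ[ ψ ∈ (ℕ → ℝ) ]
     NonzeroMeasure m × IsAbsolutelyDecaying m × Positive ψ × Decreasing ψ ×
     ¬ IsNull m (Approximable ψ) × ¬ IsNull m (∁ (Approximable ψ)))
  ×
  (Σ[ m ∈ Measure ] Σ[ ψ ∈ (ℕ → ℝ) ]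
     NonzeroMeasure m × IsAbsolutelyDecaying m × Positive ψ × Decreasing ψ ×
     ¬ (AlmostEvery m (Approximable ψ) ⇔ KhinchinSeriesDiverges ψ))
corollary1p7 em R =
  (pushforward , ψ , nonzero , absolutelyDecaying , ψ-positive , ψ-decreasing ,
    not-null false well-approximable , not-approximable-not-null) ,
  (pushforward , ψ , nonzero , absolutelyDecaying , ψ-positive , ψ-decreasing ,
    -- The series diverges, so the equivalence would make almost every point approximable; it fails
    -- in this direction.
    λ equivalence → not-approximable-not-null (Equivalence.from equivalence series-diverges))
  where open CantorMeasure em R
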